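{- Let $f$ be an $n$-variate real polynomial that is nonnegative on the constrained hypercube $\mathcal{H}_{\mathcal{P}}$ with $|\mathcal{P}| = \mathrm{poly}(n)$. Assume that there exists a degree $d$ SONC certificate for $f$. Then there exists a degree $d$ SONC certificate for $f$ involving at most $O\!\left(\binom{n}{\le d}\right)$ many nonnegative circuit polynomials, where $\binom{n}{\le d} = \sum_{k=0}^d \binom{n}{k}$.
   Context: $\mathbb{N}$ contains $0$, $\mathbb{N}^* = \mathbb{N}\setminus\{0\}$, and $[n]=\{1,\dots,n\}$. The condition $|\mathcal{P}|=\mathrm{poly}(n)$ means that the number of constraint polynomials is polynomially bounded in $n$. A circuit polynomial is a polynomial $f(\mathbf{x}) = \sum_{j=0}^r f_{\boldsymbol{\alpha}(j)} \mathbf{x}^{\boldsymbol{\alpha}(j)} + f_{\boldsymbol{\beta}} \mathbf{x}^{\boldsymbol{\beta}}$ in $\mathbb{R}[x_1,\dots,x_n]$ with $r \le n$, exponents $\boldsymbol{\alpha}(j),\boldsymbol{\beta} \in \mathbb{N}^n$, $f_{\boldsymbol{\alpha}(j)} > 0$, $f_{\boldsymbol{\beta}} \in \mathbb{R}$, such that the Newton polytope of $f$ is a simplex with vertices $\boldsymbol{\alpha}(0),\dots,\boldsymbol{\alpha}(r) \in (2\mathbb{N})^n$ and $\boldsymbol{\beta}$ lies in the (relative) interior of this simplex. Monomial squares $c\,\mathbf{x}^{\boldsymbol{\alpha}}$ with $c>0$ and $\boldsymbol{\alpha} \in (2\mathbb{N})^n$ count as nonnegative circuit polynomials. A circuit polynomial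 is nonnegative if it is nonnegative on all of $\mathbb{R}^n$. A SONC polynomial is a finite sum $\sum_i \mu_i q_i$ with $\mu_i \ge 0$ and $q_i$ nonnegative circuit polynomials. Let $a_j<b_j$ be real numbers and $g_j(\mathbf{x}) = (x_j-a_j)(x_j-b_j)$ for $j \in [n]$. For a set $\mathcal{P} = \{p_1,\dots,p_m\} \subset \mathbb{R}[x_1,\dots,x_n]$, $$\mathcal{H}_{\mathcal{P}} = \{\mathbf{x} \in \mathbb{R}^n : g_j(\mathbf{x}) = 0 \text{ for } j \in [n],\ p(\mathbf{x}) \ge 0 \text{ for } p \in \mathcal{P}\}.$$ A degree $d$ SONC certificate for $f$ (on $\mathcal{H}_{\mathcal{P}}$) is a decomposition, for some $q \in \mathbb{N}^*$, $$f(\mathbf{x}) = \sum_{\text{finite}} s(\mathbf{x}) H^{(q)}(\mathbf{x}),$$ where each $s$ is a SONC polynomial, each $H^{(q)}$ is a product of $q$ polynomials from $\{1,\ \pm g_j,\ x_j-a_j,\ b_j-x_j,\ p_i : j\in[n],\ i\in[m]\}$, and $\deg\left(\sum_{\text{finite}} s(\mathbf{x}) H^{(q)}(\mathbf{x})\right) \le d$.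
   Formalization: The degree bound d is imposed on each summand s·H of a certificate rather than on the sum after cancellation (which only bounds deg f and makes the claim false, e.g. f=(Σx_i−k)(Σx_i−k−1), n=2k, d=2); circuit polynomials are counted with multiplicity; the O-constant depends on d. -}

module Defs where

open import Level using (0ℓ)
open import Algebra.Bundles using (CommutativeRing; Semiring)
open import Data.Nat.Base as ℕ using (ℕ; suc)
open import Data.Nat.Combinatorics using (_C_)
import Data.Nat.Divisibility as ℕᵈ
open import Data.Bool.Base using (if_then_else_)
open import Data.Fin.Base using (Fin)
open import Data.Vec.Base as Vec using (Vec)
import Data.Vec.Properties as Vecₚ
open import Data.Vec.Relation.Unary.All as VecAll using ()
open import Data.List.Base as List using (List; []; _∷_; _++_)
open import Data.List.Relation.Unary.All using (All)
open import Data.Product.Base using (Σ; ∃; ∃-syntax; _×_; _,_)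
open import Data.Sum.Base using (_⊎_)
open import Function.Bundles using (_⇔_)
open import Relation.Binary.Core using (Rel)
open import Relation.Binary.Structures using (IsDecTotalOrder)
import Relation.Binary.Construct.NonStrictToStrict as NonStrictToStrict
open import Relation.Nullary using (¬_)
open import Relation.Nullary.Decidable.Core using (does)
import Data.Nat.Properties as ℕₚ
import Data.Nat.ListAction as ℕL
import Algebra.Definitions.RawSemiring as RawSemiringDefs

-- The real numbers, axiomatised as a Dedekind-complete ordered field.  These
-- axioms characterise ℝ up to isomorphism.  Decidability of the order is part
-- of the classical reading of ℝ.
record CompleteOrderedField : Set₁ where
  field
    commutativeRing : CommutativeRing 0ℓ 0ℓ

  open CommutativeRing commutativeRing public

  infix 4 _≤_
  field
    _≤_             : Rel Carrier 0ℓ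
    isDecTotalOrder : IsDecTotalOrder _≈_ _≤_

    0≉1     : ¬ (0# ≈ 1#)
    inverse : ∀ x → ¬ (x ≈ 0#) → ∃[ y ] x * y ≈ 1#

    +-monoˡ-≤ : ∀ z {x y} → x ≤ y → x + z ≤ y + z
    *-nonNeg  : ∀ {x y} → 0# ≤ x → 0# ≤ y → 0# ≤ x * y

  UpperBound : (Carrier → Set) → Carrier → Set
  UpperBound S u = ∀ x → S x → x ≤ u

  field
    supremum : (S : Carrier → Set) → ∃ S → ∃ (UpperBound S) →
               ∃[ s ] (UpperBound S s × (∀ u → UpperBound S u → s ≤ u))

  open NonStrictToStrict _≈_ _≤_ public using (_<_)
  open RawSemiringDefs (Semiring.rawSemiring semiring) public using (_^_; sum) renaming (_×_ to _·ℕ_)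

-- binom n ≤ d, i.e. Σ_{k=0}^{d} binom n k
binom≤ : ℕ → ℕ → ℕ
binom≤ n d = ℕL.sum (List.applyUpTo (n C_) (suc d))

-- The additive c covers n = 0, where n ^ k may vanish.
PolynomiallyBounded : (ℕ → ℕ) → Set
PolynomiallyBounded π = ∃[ c ] ∃[ k ] (∀ n → π n ℕ.≤ c ℕ.* n ℕ.^ k ℕ.+ c)

module SONC (𝓡 : CompleteOrderedField) where

  open CompleteOrderedField 𝓡

  ℝ : Set
  ℝ = Carrier

  Point : ℕ → Set
  Point n = Fin n → ℝ

  infix 4 _≐_
  _≐_ : ∀ {n} → Point n → Point n → Set
  x ≐ y = ∀ i → x i ≈ y i

  Exponent : ℕ → Set
  Exponent n = Vec ℕ n

  ∣_∣ : ∀ {n} → Exponent n → ℕ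
  ∣ α ∣ = Vec.sum α

  Even : ∀ {n} → Exponent n → Set
  Even = VecAll.All (2 ℕᵈ.∣_)

  toPoint : ∀ {n} → Exponent n → Point n
  toPoint α i = Vec.lookup α i ·ℕ 1#

  -- A polynomial is a finite formal sum of terms c x^α in which exponents may
  -- repeat; polynomials are always compared by _≋_, through their coefficients.
  Poly : ℕ → Set
  Poly n = List (ℝ × Exponent n)

  coeff : ∀ {n} → Poly n → Exponent n → ℝ
  coeff []            α = 0#
  coeff ((c , β) ∷ p) α =
    if does (Vecₚ.≡-dec ℕₚ._≟_ β α) then c + coeff p α else coeff p α

  infix 4 _≋_
  _≋_ : ∀ {n} → Poly n → Poly n → Set
  p ≋ q = ∀ α → coeff p α ≈ coeff q α

  -- The zero polynomial satisfies DegreeAtMost d for every d.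
  DegreeAtMost : ∀ {n} → ℕ → Poly n → Set
  DegreeAtMost d p = ∀ α → ¬ (coeff p α ≈ 0#) → ∣ α ∣ ℕ.≤ d

  monomialAt : ∀ {n} → Point n → Exponent n → ℝ
  monomialAt x Vec.[]      = 1#
  monomialAt x (k Vec.∷ α) = x Fin.zero ^ k * monomialAt (λ i → x (Fin.suc i)) α

  eval : ∀ {n} → Poly n → Point n → ℝ
  eval []            x = 0#
  eval ((c , α) ∷ p) x = c * monomialAt x α + eval p x

  NonNegative : ∀ {n} → Poly n → Set
  NonNegative p = ∀ x → 0# ≤ eval p x

  const : ∀ {n} → ℝ → Poly n
  const {n} c = (c , Vec.replicate n 0) ∷ []

  var : ∀ {n} → Fin n → Poly n
  var {n} j = (1# , Vec.replicate n 0 Vec.[ j ]≔ 1) ∷ []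

  infixl 6 _⊕_ _⊖_
  infixl 7 _⊗_ _⊙_

  _⊕_ : ∀ {n} → Poly n → Poly n → Poly n
  p ⊕ q = p ++ q

  _⊙_ : ∀ {n} → ℝ → Poly n → Poly n
  c ⊙ p = List.map (λ (e , α) → c * e , α) p

  ⊝_ : ∀ {n} → Poly n → Poly n
  ⊝ p = List.map (λ (e , α) → - e , α) p

  _⊖_ : ∀ {n} → Poly n → Poly n → Poly n
  p ⊖ q = p ⊕ (⊝ q)

  _⊗_ : ∀ {n} → Poly n → Poly n → Poly n
  p ⊗ q = List.cartesianProductWith
            (λ (c , α) (e , β) → c * e , Vec.zipWith ℕ._+_ α β) p q

  sumPoly : ∀ {n} → List (Poly n) → Poly n
  sumPoly = List.foldr _⊕_ []

  combination : ∀ {n k} → (Fin k → ℝ) → (Fin k → Point n) → Point n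
  combination w v i = sum (λ j → w j * v j i)

  AffineHull : ∀ {n} → (Point n → Set) → Point n → Set
  AffineHull {n} S x =
    ∃[ k ] Σ (Fin k → ℝ) λ w → Σ (Fin k → Point n) λ v →
      (∀ j → S (v j)) × sum w ≈ 1# × x ≐ combination w v

  ConvexHull : ∀ {n} → (Point n → Set) → Point n → Set
  ConvexHull {n} S x =
    ∃[ k ] Σ (Fin k → ℝ) λ w → Σ (Fin k → Point n) λ v →
      (∀ j → S (v j)) × (∀ j → 0# ≤ w j) × sum w ≈ 1# × x ≐ combination w v

  -- Interior relative to the affine hull; the neighbourhoods are sup-norm balls.
  RelativeInterior : ∀ {n} → (Point n → Set) → Point n → Set
  RelativeInterior S x =
    S x × ∃[ ε ] (0# < ε ×
      (∀ y → AffineHull S y → (∀ i → y i < x i + ε × x i < y i + ε) → S y))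

  AffinelyIndependent : ∀ {n k} → (Fin k → Point n) → Set
  AffinelyIndependent {k = k} v =
    (w : Fin k → ℝ) → sum w ≈ 0# → combination w v ≐ (λ _ → 0#) → ∀ j → w j ≈ 0#

  IsSimplexWithVertices : ∀ {n k} → (Point n → Set) → (Fin k → Point n) → Set
  IsSimplexWithVertices S v =
    AffinelyIndependent v × (∀ x → S x ⇔ ConvexHull (λ y → ∃[ j ] y ≐ v j) x)

  NewtonPolytope : ∀ {n} → Poly n → Point n → Set
  NewtonPolytope p =
    ConvexHull (λ x → ∃[ α ] (¬ (coeff p α ≈ 0#) × x ≐ toPoint α))

  record IsCircuit {n} (p : Poly n) : Set where
    field
      r        : ℕ
      r≤n      : r ℕ.≤ n
      α        : Fin (suc r) → Exponent n
      β        : Exponent n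
      fα       : Fin (suc r) → ℝ
      fβ       : ℝ
      form     : p ≋ List.tabulate (λ j → fα j , α j) ⊕ ((fβ , β) ∷ [])
      positive : ∀ j → 0# < fα j
      even     : ∀ j → Even (α j)
      simplex  : IsSimplexWithVertices (NewtonPolytope p) (λ j → toPoint (α j))
      interior : RelativeInterior (NewtonPolytope p) (toPoint β)

  IsMonomialSquare : ∀ {n} → Poly n → Set
  IsMonomialSquare p = ∃[ c ] ∃[ α ] (0# < c × Even α × p ≋ ((c , α) ∷ []))

  IsNonNegativeCircuit : ∀ {n} → Poly n → Set
  IsNonNegativeCircuit p = (IsCircuit p × NonNegative p) ⊎ IsMonomialSquare p

  record WeightedCircuit (n : ℕ) : Set where
    field
      μ         : ℝ
      μ≥0       : 0# ≤ μ
      q         : Poly n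
      q-circuit : IsNonNegativeCircuit q

  -- A SONC polynomial is given together with a decomposition Σᵢ μᵢ qᵢ, so that
  -- the circuit polynomials it involves can be counted.
  SONCPoly : ℕ → Set
  SONCPoly n = List (WeightedCircuit n)

  ⟦_⟧ : ∀ {n} → SONCPoly n → Poly n
  ⟦ s ⟧ = sumPoly (List.map (λ t → WeightedCircuit.μ t ⊙ WeightedCircuit.q t) s)

  record ConstrainedHypercube (n m : ℕ) : Set where
    field
      a b : Fin n → ℝ
      a<b : ∀ j → a j < b j
      p   : Fin m → Poly n

    g : Fin n → Poly n
    g j = (var j ⊖ const (a j)) ⊗ (var j ⊖ const (b j))

    Member : Point n → Set
    Member x = (∀ j → eval (g j) x ≈ 0#) × (∀ i → 0# ≤ eval (p i) x)

    data Factor : Set where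
      one         : Factor
      +g -g       : Fin n → Factor
      x-a b-x     : Fin n → Factor
      constraint  : Fin m → Factor

    factor : Factor → Poly n
    factor one            = const 1#
    factor (+g j)         = g j
    factor (-g j)         = ⊝ g j
    factor (x-a j)        = var j ⊖ const (a j)
    factor (b-x j)        = const (b j) ⊖ var j
    factor (constraint i) = p i

    productOf : ∀ {q} → Vec Factor q → Poly n
    productOf = Vec.foldr _ (λ h acc → factor h ⊗ acc) (const 1#)

  NonNegativeOn : ∀ {n m} → ConstrainedHypercube n m → Poly n → Set
  NonNegativeOn 𝓗 f = ∀ x → ConstrainedHypercube.Member 𝓗 x → 0# ≤ eval f x

  -- The degree of a certificate is that of the decomposition, i.e. the largest
  -- degree of a summand s H.  Bounding only the degree of the sum after
  -- cancellation would bound nothing but the degree of f.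
  record Certificate {n m} (𝓗 : ConstrainedHypercube n m) (d : ℕ) (f : Poly n) : Set where
    open ConstrainedHypercube 𝓗 using (Factor; productOf)

    field
      q        : ℕ
      q≥1      : 1 ℕ.≤ q
      summands : List (SONCPoly n × Vec Factor q)

    value : SONCPoly n × Vec Factor q → Poly n
    value (s , H) = ⟦ s ⟧ ⊗ productOf H

    field
      decomposition : f ≋ sumPoly (List.map value summands)
      degree        : All (λ t → DegreeAtMost d (value t)) summands

    -- Occurrences are counted with multiplicity.
    circuitCount : ℕ
    circuitCount = ℕL.sum (List.map (λ (s , _) → List.length s) summands)

{-# OPTIONS --safe #-}
-- Every nonnegative circuit polynomial q occurring in the certificate contributes a vector
-- q H, and f is a conic combination of these vectors.  By Carathéodory's theorem for cones
-- no more of them are needed than the dimension of the space they span.  This space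
-- consists of polynomials of degree at most d: a summand s H has degree at most d, and no
-- cancellation can occur among the circuit polynomials in s, because in a monomial order
-- refining the degree the leading coefficient of a nonnegative polynomial is nonnegative.
-- Finally C(n+d,d) ≤ 2^d Σ_{k≤d} C(n,k).
module Submission where

open import Defs
open import Data.Nat.Base as ℕ using (ℕ; zero; suc; z≤n; s≤s)
import Data.Nat.Properties as ℕ
import Data.Nat.ListAction as ℕ
open import Data.Fin.Base using (Fin; zero; suc; punchIn)
open import Data.Fin.Properties using (any?)
open import Data.Bool.Base using (if_then_else_)
open import Data.List.Base using (List; []; _∷_; _++_; map; filter; foldr; length; lookup; concatMap; tabulate; allFin; applyUpTo)
open import Data.List.Properties using (length-map; length-++)
open import Data.List.Membership.Propositional using (_∈_)
open import Data.List.Membership.Propositional.Properties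
  using (∈-map⁺; ∈-++⁺ˡ; ∈-++⁺ʳ; ∈-filter⁺; ∈-filter⁻; ∈-allFin; ∈-concatMap⁺)
import Data.List.Extrema as Extrema
open import Data.List.Extrema.Nat using (argmax; argmax-all; f[xs]≤f[argmax]; max; xs≤max)
open import Data.List.Relation.Unary.All as All using (All; []; _∷_)
open import Data.List.Relation.Unary.All.Properties using (all-filter; tabulate⁺)
open import Data.List.Relation.Unary.Any as Any using (Any; here; there)
open import Data.Product.Base using (∃-syntax; Σ-syntax; _×_; _,_; proj₁; proj₂)
open import Data.Sum.Base using (_⊎_; inj₁; inj₂)
open import Data.Vec.Base as Vec using (Vec; []; _∷_)
import Data.Vec.Properties as Vec
open import Data.Vec.Functional using (insertAt)
open import Data.Vec.Functional.Properties using (insertAt-lookup; insertAt-punchIn)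
open import Function.Base using (_∘_; id)
open import Relation.Nullary using (¬_; Dec; yes; no; does; contradiction; ¬?; _×-dec_)
open import Relation.Nullary.Decidable using (decidable-stable; dec-true; dec-false)
open import Relation.Unary using (Decidable)
open import Relation.Binary.Bundles using (Poset; TotalOrder)
open import Relation.Binary.Structures using (IsDecTotalOrder)
import Relation.Binary.PropositionalEquality as ≡
open ≡ using (_≡_; _≢_)

-- The degree bound on each single `q H` serves twice: it confines the vectors to finitely many
-- coordinates, and it keeps the new certificate of degree `d`, since a certificate bounds its
-- summands one by one. The given bound concerns `s H` only, where terms of high degree from
-- different circuits might have cancelled. At the largest exponent found in any circuit of nonzero
-- weight in `s`, all these circuits have coefficients at least 0, so the coefficients add up to a
-- nonzero number. The sign of `H` is unknown; there it is enough that the product of the two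
-- leading terms is met by no other pair of terms. The monomial order is given by natural number
-- weights, because the sign of a leading coefficient is read off on a curve `x i = T ^ w i`. In two
-- or more variables no such weights separate all exponents, so they are chosen anew for each
-- summand, large enough for the exponents present.

-- Counting exponent vectors of bounded degree

module Exponents where

  open import Data.Nat.Base
  open import Data.Nat.Properties
  open import Data.Nat.Combinatorics using (_C_; nCn≡1; nCk≡nC[n∸k]; nCk+nC[k+1]≡[n+1]C[k+1])
  open import Data.Nat.DivMod using (_%_; [m+kn]%n≡m%n; m<n⇒m%n≡m)
  open import Data.Nat.ListAction using (sum)
  open import Data.Nat.Solver using (module +-*-Solver)
  open ≡ using (refl; sym; trans; cong; cong₂; module ≡-Reasoning)

  nC0≡1 : ∀ n → n C 0 ≡ 1
  nC0≡1 n = trans (nCk≡nC[n∸k] {n = n} z≤n) (nCn≡1 n)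

  sum-applyUpTo-+ : ∀ {f g h : ℕ → ℕ} → (∀ i → f i + g i ≡ h i) → ∀ k →
                    sum (applyUpTo h k) ≡ sum (applyUpTo f k) + sum (applyUpTo g k)
  sum-applyUpTo-+ f+g≗h zero = refl
  sum-applyUpTo-+ {f} {g} {h} f+g≗h (suc k) = begin
    h 0 + sum (applyUpTo (h ∘ suc) k)
      ≡⟨ cong₂ _+_ (sym (f+g≗h 0)) (sum-applyUpTo-+ (f+g≗h ∘ suc) k) ⟩
    f 0 + g 0 + (F + G)
      ≡⟨ solve 4 (λ a b c d → a :+ b :+ (c :+ d) := a :+ c :+ (b :+ d)) refl (f 0) (g 0) F G ⟩
    f 0 + F + (g 0 + G) ∎
    where
    open ≡-Reasoning
    open +-*-Solver
    F = sum (applyUpTo (f ∘ suc) k)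
    G = sum (applyUpTo (g ∘ suc) k)

  sum-applyUpTo-≤-suc : ∀ f k → sum (applyUpTo f k) ≤ sum (applyUpTo f (suc k))
  sum-applyUpTo-≤-suc f zero    = z≤n
  sum-applyUpTo-≤-suc f (suc k) = +-monoʳ-≤ (f 0) (sum-applyUpTo-≤-suc (f ∘ suc) k)

  binom≤-zero : ∀ n → binom≤ n 0 ≡ 1
  binom≤-zero n = cong (_+ 0) (nC0≡1 n)

  binom≤-≤-suc : ∀ n d → binom≤ n d ≤ binom≤ n (suc d)
  binom≤-≤-suc n d = sum-applyUpTo-≤-suc (n C_) (suc d)

  binom≤-pos : ∀ n d → 1 ≤ binom≤ n d
  binom≤-pos n zero    = ≤-reflexive (sym (binom≤-zero n))
  binom≤-pos n (suc d) = ≤-trans (binom≤-pos n d) (binom≤-≤-suc n d)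

  binom≤-pascal : ∀ n d → binom≤ (suc n) (suc d) ≡ binom≤ n (suc d) + binom≤ n d
  binom≤-pascal n d = begin
    suc n C 0 + sum (applyUpTo ((suc n C_) ∘ suc) (suc d))
      ≡⟨ cong₂ _+_ (trans (nC0≡1 (suc n)) (sym (nC0≡1 n)))
                   (sum-applyUpTo-+ {n C_} {(n C_) ∘ suc} (nCk+nC[k+1]≡[n+1]C[k+1] n) (suc d)) ⟩
    n C 0 + (binom≤ n d + rest)
      ≡⟨ cong (n C 0 +_) (+-comm (binom≤ n d) rest) ⟩
    n C 0 + (rest + binom≤ n d)
      ≡⟨ +-assoc (n C 0) rest (binom≤ n d) ⟨
    binom≤ n (suc d) + binom≤ n d ∎
    where
    open ≡-Reasoning
    rest = sum (applyUpTo ((n C_) ∘ suc) (suc d))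

  -- By Pascal's rule the left side is a sum of two terms, each at most `binom≤ n d`. This pays for
  -- the index mismatch in `length-exponentsUpTo`.
  binom≤-suc-≤-double : ∀ n d → binom≤ (suc n) d ≤ 2 * binom≤ n d
  binom≤-suc-≤-double n zero = begin
    binom≤ (suc n) 0  ≡⟨ trans (binom≤-zero (suc n)) (sym (binom≤-zero n)) ⟩
    binom≤ n 0        ≤⟨ m≤m+n _ _ ⟩
    2 * binom≤ n 0    ∎
    where open ≤-Reasoning
  binom≤-suc-≤-double n (suc d) = begin
    binom≤ (suc n) (suc d)                    ≡⟨ binom≤-pascal n d ⟩
    binom≤ n (suc d) + binom≤ n d             ≤⟨ +-monoʳ-≤ (binom≤ n (suc d)) (binom≤-≤-suc n d) ⟩
    binom≤ n (suc d) + binom≤ n (suc d)       ≡⟨ cong (binom≤ n (suc d) +_) (+-identityʳ _) ⟨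
    2 * binom≤ n (suc d)                      ∎
    where open ≤-Reasoning

  incrementHead : ∀ {n} → Vec ℕ (suc n) → Vec ℕ (suc n)
  incrementHead (k ∷ α) = suc k ∷ α

  -- Splits on whether the first exponent is zero or positive. This is Pascal's recursion for the
  -- binomial coefficient of `n + d` over `d`, in a form that can be compared with `binom≤-pascal`.
  exponentsUpTo : ∀ n → ℕ → List (Vec ℕ n)
  exponentsUpTo zero    d       = [] ∷ []
  exponentsUpTo (suc n) zero    = map (0 ∷_) (exponentsUpTo n zero)
  exponentsUpTo (suc n) (suc d) =
    map (0 ∷_) (exponentsUpTo n (suc d)) ++ map incrementHead (exponentsUpTo (suc n) d)

  ∈-exponentsUpTo : ∀ {n d} (α : Vec ℕ n) → Vec.sum α ≤ d → α ∈ exponentsUpTo n d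
  ∈-exponentsUpTo                 []          _       = here refl
  ∈-exponentsUpTo {d = zero}      (zero ∷ α)  α≤d     = ∈-map⁺ (0 ∷_) (∈-exponentsUpTo α α≤d)
  ∈-exponentsUpTo {d = suc d}     (zero ∷ α)  α≤d     = ∈-++⁺ˡ (∈-map⁺ (0 ∷_) (∈-exponentsUpTo α α≤d))
  ∈-exponentsUpTo {suc n} {suc d} (suc k ∷ α) (s≤s p) =
    ∈-++⁺ʳ (map (0 ∷_) (exponentsUpTo n (suc d))) (∈-map⁺ incrementHead (∈-exponentsUpTo (k ∷ α) p))

  -- The recursions of the two sides differ in one term, at `(suc n , d)` on the left and at
  -- `(n , d)` on the right. Correcting it costs one doubling each time `d` decreases, hence the
  -- factor `2 ^ d`.
  length-exponentsUpTo : ∀ n d → length (exponentsUpTo n d) ≤ 2 ^ d * binom≤ n d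
  length-exponentsUpTo zero    d       = *-mono-≤ (m^n>0 2 d) (binom≤-pos 0 d)
  length-exponentsUpTo (suc n) zero    = begin
    length (exponentsUpTo (suc n) zero)  ≡⟨ length-map _ (exponentsUpTo n zero) ⟩
    length (exponentsUpTo n zero)        ≤⟨ length-exponentsUpTo n zero ⟩
    1 * binom≤ n 0                       ≡⟨ cong (1 *_) (trans (binom≤-zero n) (sym (binom≤-zero (suc n)))) ⟩
    1 * binom≤ (suc n) 0                 ∎
    where open ≤-Reasoning
  length-exponentsUpTo (suc n) (suc d) = begin
    length (exponentsUpTo (suc n) (suc d))
      ≡⟨ length-++ (map (0 ∷_) (exponentsUpTo n (suc d))) ⟩
    length (map (0 ∷_) (exponentsUpTo n (suc d))) + length (map incrementHead (exponentsUpTo (suc n) d))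
      ≡⟨ cong₂ _+_ (length-map _ (exponentsUpTo n (suc d))) (length-map _ (exponentsUpTo (suc n) d)) ⟩
    length (exponentsUpTo n (suc d)) + length (exponentsUpTo (suc n) d)
      ≤⟨ +-mono-≤ (length-exponentsUpTo n (suc d)) (length-exponentsUpTo (suc n) d) ⟩
    2 ^ suc d * binom≤ n (suc d) + 2 ^ d * binom≤ (suc n) d
      ≤⟨ +-monoʳ-≤ (2 ^ suc d * binom≤ n (suc d)) (*-monoʳ-≤ (2 ^ d) (binom≤-suc-≤-double n d)) ⟩
    2 ^ suc d * binom≤ n (suc d) + 2 ^ d * (2 * binom≤ n d)
      ≡⟨ solve 3 (λ x b c → con 2 :* x :* b :+ x :* (con 2 :* c) := con 2 :* x :* (b :+ c)) refl
           (2 ^ d) (binom≤ n (suc d)) (binom≤ n d) ⟩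
    2 ^ suc d * (binom≤ n (suc d) + binom≤ n d)
      ≡⟨ cong (2 ^ suc d *_) (binom≤-pascal n d) ⟨
    2 ^ suc d * binom≤ (suc n) (suc d) ∎
    where
    open ≤-Reasoning
    open +-*-Solver

  -- Weights on exponents and the graded Kronecker order

  sum-zipWith-+ : ∀ {n} (α β : Vec ℕ n) → Vec.sum (Vec.zipWith _+_ α β) ≡ Vec.sum α + Vec.sum β
  sum-zipWith-+ []      []      = refl
  sum-zipWith-+ (k ∷ α) (l ∷ β) = trans (cong (k + l +_) (sum-zipWith-+ α β))
    (solve 4 (λ a b c d → a :+ b :+ (c :+ d) := a :+ c :+ (b :+ d)) refl k l (Vec.sum α) (Vec.sum β))
    where open +-*-Solver

  -- Exponents are compared through a linear functional rather than lexicographically: on the curve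
  -- `x i = T ^ w i` the monomial of `α` takes the value `T ^ weight w α`.
  weight : ∀ {n} → (Fin n → ℕ) → Vec ℕ n → ℕ
  weight w []      = 0
  weight w (k ∷ α) = w zero * k + weight (w ∘ suc) α

  weight-zipWith-+ : ∀ {n} (w : Fin n → ℕ) (α β : Vec ℕ n) →
                     weight w (Vec.zipWith _+_ α β) ≡ weight w α + weight w β
  weight-zipWith-+ w []      []      = refl
  weight-zipWith-+ w (k ∷ α) (l ∷ β) =
    trans (cong (w zero * (k + l) +_) (weight-zipWith-+ (w ∘ suc) α β))
    (solve 5 (λ x a b c d → x :* (a :+ b) :+ (c :+ d) := x :* a :+ c :+ (x :* b :+ d)) refl
       (w zero) k l (weight (w ∘ suc) α) (weight (w ∘ suc) β))
    where open +-*-Solver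

  head< : ∀ {n B} k (α : Vec ℕ n) → Vec.sum (k ∷ α) < B → k < B
  head< k α = ≤-<-trans (m≤m+n k (Vec.sum α))

  tail< : ∀ {n B} k (α : Vec ℕ n) → Vec.sum (k ∷ α) < B → Vec.sum α < B
  tail< k α = ≤-<-trans (m≤n+m (Vec.sum α) k)

  module Kronecker (B : ℕ) .{{_ : NonZero B}} where

    -- The number with base `B` digits `α`, lowest digit first; it is the exponent of the monomial
    -- after Kronecker substitution.
    code : ∀ {n} → Vec ℕ n → ℕ
    code []      = 0
    code (k ∷ α) = k + code α * B

    code< : ∀ {n} (α : Vec ℕ n) → Vec.sum α < B → code α < B ^ n
    code< []              _   = ≤-refl
    code< {suc n} (k ∷ α) α<B = begin-strict
      k + code α * B    <⟨ +-monoˡ-< (code α * B) (head< k α α<B) ⟩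
      suc (code α) * B  ≤⟨ *-monoˡ-≤ B (code< α (tail< k α α<B)) ⟩
      B ^ n * B         ≡⟨ *-comm (B ^ n) B ⟩
      B * B ^ n         ∎
      where open ≤-Reasoning

    code-injective : ∀ {n} (α β : Vec ℕ n) → Vec.sum α < B → Vec.sum β < B →
                     code α ≡ code β → α ≡ β
    code-injective []      []      _   _   _  = refl
    code-injective (k ∷ α) (l ∷ β) α<B β<B eq = cong₂ _∷_ k≡l
      (code-injective α β (tail< k α α<B) (tail< l β β<B)
        (*-cancelʳ-≡ _ _ B (+-cancelˡ-≡ k _ _ (trans eq (cong (_+ code β * B) (sym k≡l))))))
      where
      open ≡-Reasoning
      k≡l : k ≡ l
      k≡l = begin
        k                     ≡⟨ m<n⇒m%n≡m (head< k α α<B) ⟨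
        k % B                 ≡⟨ [m+kn]%n≡m%n k (code α) B ⟨
        (k + code α * B) % B  ≡⟨ cong (_% B) eq ⟩
        (l + code β * B) % B  ≡⟨ [m+kn]%n≡m%n l (code β) B ⟩
        l % B                 ≡⟨ m<n⇒m%n≡m (head< l β β<B) ⟩
        l                     ∎

    -- The summand `c` is a separate parameter because `B ^ n` has to refer to the full dimension
    -- while the recursion shortens the vector; `e` accumulates the power of `B`.
    weights : ℕ → ℕ → ∀ {n} → Fin n → ℕ
    weights c e zero    = c + e
    weights c e (suc i) = weights c (e * B) i

    weight-weights : ∀ c e {n} (α : Vec ℕ n) →
                     weight (weights c e) α ≡ Vec.sum α * c + e * code α
    weight-weights c e []      = sym (*-zeroʳ e)
    weight-weights c e (k ∷ α) =
      trans (cong ((c + e) * k +_) (weight-weights c (e * B) α))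
      (solve 6 (λ c e k s b q → (c :+ e) :* k :+ (s :* c :+ e :* b :* q) :=
                                (k :+ s) :* c :+ e :* (k :+ q :* b)) refl
         c e k (Vec.sum α) B (code α))
      where open +-*-Solver

    -- Adding Bⁿ to the Kronecker weights Bⁱ makes the total degree dominate.
    gradedWeights : ∀ {n} → Fin n → ℕ
    gradedWeights {n} = weights (B ^ n) 1

    gradedWeight-≡ : ∀ {n} (α : Vec ℕ n) →
                     weight gradedWeights α ≡ Vec.sum α * B ^ n + code α
    gradedWeight-≡ {n} α = trans (weight-weights (B ^ n) 1 α)
                                 (cong (Vec.sum α * B ^ n +_) (*-identityˡ (code α)))

    -- The weight is the degree times `B ^ n` plus a code, and the code of `β` is below `B ^ n`. A
    -- larger degree of `α` could therefore not be compensated by the code of `β`.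
    gradedWeight-mono⁻ : ∀ {n} (α β : Vec ℕ n) → Vec.sum β < B →
                         weight gradedWeights α ≤ weight gradedWeights β → Vec.sum α ≤ Vec.sum β
    gradedWeight-mono⁻ {n} α β β<B wα≤wβ = ≮⇒≥ λ β<α → <⇒≱ (begin-strict
      weight gradedWeights β      ≡⟨ gradedWeight-≡ β ⟩
      Vec.sum β * B ^ n + code β  <⟨ +-monoʳ-< (Vec.sum β * B ^ n) (code< β β<B) ⟩
      Vec.sum β * B ^ n + B ^ n   ≡⟨ +-comm (Vec.sum β * B ^ n) (B ^ n) ⟩
      suc (Vec.sum β) * B ^ n     ≤⟨ *-monoˡ-≤ (B ^ n) β<α ⟩
      Vec.sum α * B ^ n           ≤⟨ m≤m+n _ (code α) ⟩
      Vec.sum α * B ^ n + code α  ≡⟨ gradedWeight-≡ α ⟨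
      weight gradedWeights α      ∎) wα≤wβ
      where open ≤-Reasoning

    gradedWeight-injective : ∀ {n} (α β : Vec ℕ n) → Vec.sum α < B → Vec.sum β < B →
                             weight gradedWeights α ≡ weight gradedWeights β → α ≡ β
    gradedWeight-injective {n} α β α<B β<B eq = code-injective α β α<B β<B
      (+-cancelˡ-≡ (Vec.sum α * B ^ n) _ _ (begin
        Vec.sum α * B ^ n + code α  ≡⟨ gradedWeight-≡ α ⟨
        weight gradedWeights α      ≡⟨ eq ⟩
        weight gradedWeights β      ≡⟨ gradedWeight-≡ β ⟩
        Vec.sum β * B ^ n + code β  ≡⟨ cong (λ s → s * B ^ n + code β) (sym degrees-agree) ⟩
        Vec.sum α * B ^ n + code β  ∎))
      where
      open ≡-Reasoning
      degrees-agree : Vec.sum α ≡ Vec.sum β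
      degrees-agree = ≤-antisym (gradedWeight-mono⁻ α β β<B (≤-reflexive eq))
                                (gradedWeight-mono⁻ β α α<B (≤-reflexive (sym eq)))

open Exponents

-- Arithmetic in an ordered field

module OrderedField (𝓡 : CompleteOrderedField) where

  open CompleteOrderedField 𝓡 hiding (zero)
  open IsDecTotalOrder isDecTotalOrder public
    using (_≟_; _≤?_; total; antisym; isPartialOrder; isTotalOrder)
    renaming (trans to ≤-trans; reflexive to ≤-reflexive; refl to ≤-refl)
  open import Algebra.Properties.Ring ring public
    using (-‿distribˡ-*; -‿distribʳ-*; -‿involutive; -0#≈0#)
  open import Algebra.Properties.Semiring.Sum semiring public
    using (sum-remove; ∑-distrib-+; *-distribˡ-sum; *-distribʳ-sum; sum-cong-≋; sum-replicate-zero)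

  ≤-totalOrder : TotalOrder _ _ _
  ≤-totalOrder = record { isTotalOrder = isTotalOrder }

  ≤-poset : Poset _ _ _
  ≤-poset = record { isPartialOrder = isPartialOrder }

  module ≤-Reasoning where
    open import Relation.Binary.Reasoning.PartialOrder ≤-poset public

  module ≈-Reasoning where
    open import Relation.Binary.Reasoning.Setoid setoid public

  infix 4 _<?_
  _<?_ : ∀ x y → Dec (x < y)
  x <? y = (x ≤? y) ×-dec ¬? (x ≟ y)

  ≮⇒≥ : ∀ {x y} → ¬ x < y → y ≤ x
  ≮⇒≥ {x} {y} x≮y with total x y | x ≟ y
  ... | inj₂ y≤x | _       = y≤x
  ... | inj₁ _   | yes x≈y = ≤-reflexive (sym x≈y)
  ... | inj₁ x≤y | no x≉y  = contradiction (x≤y , x≉y) x≮y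

  +-mono-≤ : ∀ {x y u v} → x ≤ y → u ≤ v → x + u ≤ y + v
  +-mono-≤ {x} {y} {u} {v} x≤y u≤v = begin
    x + u  ≤⟨ +-monoˡ-≤ u x≤y ⟩
    y + u  ≈⟨ +-comm y u ⟩
    u + y  ≤⟨ +-monoˡ-≤ y u≤v ⟩
    v + y  ≈⟨ +-comm v y ⟩
    y + v  ∎
    where open ≤-Reasoning

  +-nonNeg : ∀ {x y} → 0# ≤ x → 0# ≤ y → 0# ≤ x + y
  +-nonNeg 0≤x 0≤y = ≤-trans (≤-reflexive (sym (+-identityˡ 0#))) (+-mono-≤ 0≤x 0≤y)

  x≤y⇒0≤y-x : ∀ {x y} → x ≤ y → 0# ≤ y - x
  x≤y⇒0≤y-x {x} x≤y = ≤-trans (≤-reflexive (sym (-‿inverseʳ x))) (+-monoˡ-≤ (- x) x≤y)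

  y-x+x≈y : ∀ y x → y - x + x ≈ y
  y-x+x≈y y x = trans (+-assoc y (- x) x) (trans (+-congˡ (-‿inverseˡ x)) (+-identityʳ y))

  0≤y-x⇒x≤y : ∀ {x y} → 0# ≤ y - x → x ≤ y
  0≤y-x⇒x≤y {x} {y} 0≤y-x = begin
    x          ≈⟨ +-identityˡ x ⟨
    0# + x     ≤⟨ +-monoˡ-≤ x 0≤y-x ⟩
    y - x + x  ≈⟨ y-x+x≈y y x ⟩
    y          ∎
    where open ≤-Reasoning

  x≤0⇒0≤-x : ∀ {x} → x ≤ 0# → 0# ≤ - x
  x≤0⇒0≤-x {x} x≤0 = ≤-trans (x≤y⇒0≤y-x x≤0) (≤-reflexive (+-identityˡ (- x)))

  *-monoˡ-≤ : ∀ {x y z} → 0# ≤ z → x ≤ y → z * x ≤ z * y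
  *-monoˡ-≤ {x} {y} {z} 0≤z x≤y = 0≤y-x⇒x≤y (begin
    0#               ≤⟨ *-nonNeg 0≤z (x≤y⇒0≤y-x x≤y) ⟩
    z * (y - x)      ≈⟨ distribˡ z y (- x) ⟩
    z * y + z * - x  ≈⟨ +-congˡ (-‿distribʳ-* z x) ⟨
    z * y - z * x    ∎)
    where open ≤-Reasoning

  *-nonNeg-nonPos : ∀ {x y} → 0# ≤ x → y ≤ 0# → x * y ≤ 0#
  *-nonNeg-nonPos {x} 0≤x y≤0 = ≤-trans (*-monoˡ-≤ 0≤x y≤0) (≤-reflexive (zeroʳ x))

  0≤1 : 0# ≤ 1#
  0≤1 with total 0# 1#
  ... | inj₁ 0≤1 = 0≤1
  ... | inj₂ 1≤0 = begin
    0#           ≤⟨ *-nonNeg (x≤0⇒0≤-x 1≤0) (x≤0⇒0≤-x 1≤0) ⟩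
    - 1# * - 1#  ≈⟨ -‿distribˡ-* 1# (- 1#) ⟨
    - (1# * - 1#) ≈⟨ -‿cong (*-identityˡ (- 1#)) ⟩
    - - 1#       ≈⟨ -‿involutive 1# ⟩
    1#           ∎
    where open ≤-Reasoning

  infix 8 _⁻¹
  -- The reciprocal of 0 is 0.
  _⁻¹ : Carrier → Carrier
  x ⁻¹ with x ≟ 0#
  ... | yes _   = 0#
  ... | no x≉0  = proj₁ (inverse x x≉0)

  ⁻¹-inverseʳ : ∀ {x} → x ≉ 0# → x * x ⁻¹ ≈ 1#
  ⁻¹-inverseʳ {x} x≉0 with x ≟ 0#
  ... | yes x≈0 = contradiction x≈0 x≉0
  ... | no x≉0  = proj₂ (inverse x x≉0)

  ⁻¹-inverseˡ : ∀ {x} → x ≉ 0# → x ⁻¹ * x ≈ 1#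
  ⁻¹-inverseˡ {x} x≉0 = trans (*-comm (x ⁻¹) x) (⁻¹-inverseʳ x≉0)

  ⁻¹-nonNeg : ∀ {x} → 0# < x → 0# ≤ x ⁻¹
  ⁻¹-nonNeg {x} (0≤x , 0≉x) with total 0# (x ⁻¹)
  ... | inj₁ 0≤x⁻¹ = 0≤x⁻¹
  ... | inj₂ x⁻¹≤0 = contradiction (antisym 0≤1 (begin
    1#         ≈⟨ ⁻¹-inverseʳ (0≉x ∘ sym) ⟨
    x * x ⁻¹   ≤⟨ *-nonNeg-nonPos 0≤x x⁻¹≤0 ⟩
    0#         ∎)) 0≉1
    where open ≤-Reasoning

  x*y*y⁻¹≈x : ∀ x {y} → y ≉ 0# → x * y ⁻¹ * y ≈ x
  x*y*y⁻¹≈x x {y} y≉0 = trans (*-assoc x (y ⁻¹) y) (trans (*-congˡ (⁻¹-inverseˡ y≉0)) (*-identityʳ x))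

  *-≉0 : ∀ {x y} → x ≉ 0# → y ≉ 0# → x * y ≉ 0#
  *-≉0 {x} {y} x≉0 y≉0 xy≈0 = x≉0 (begin
    x             ≈⟨ *-identityʳ x ⟨
    x * 1#        ≈⟨ *-congˡ (⁻¹-inverseʳ y≉0) ⟨
    x * (y * y ⁻¹) ≈⟨ *-assoc x y (y ⁻¹) ⟨
    x * y * y ⁻¹  ≈⟨ *-congʳ xy≈0 ⟩
    0# * y ⁻¹     ≈⟨ zeroˡ (y ⁻¹) ⟩
    0#            ∎)
    where open ≈-Reasoning

  -- Linear dependencies and Carathéodory's theorem for cones

  sum-zero : ∀ {k} {t : Fin k → Carrier} → (∀ i → t i ≈ 0#) → sum t ≈ 0#
  sum-zero {k} t≈0 = trans (sum-cong-≋ t≈0) (sum-replicate-zero k)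

  x*[y-z*w]≈x*y-x*z*w : ∀ x y z w → x * (y - z * w) ≈ x * y + - (x * z) * w
  x*[y-z*w]≈x*y-x*z*w x y z w = begin
    x * (y - z * w)           ≈⟨ distribˡ x y (- (z * w)) ⟩
    x * y + x * - (z * w)     ≈⟨ +-congˡ (-‿distribʳ-* x (z * w)) ⟨
    x * y + - (x * (z * w))   ≈⟨ +-congˡ (-‿cong (*-assoc x z w)) ⟨
    x * y + - (x * z * w)     ≈⟨ +-congˡ (-‿distribˡ-* (x * z) w) ⟩
    x * y + - (x * z) * w     ∎
    where open ≈-Reasoning

  module _ {A : Set} where

    -- Gaussian elimination, one coordinate of `L` at a time. If all vectors vanish at the
    -- coordinate, it imposes nothing. Otherwise a pivot `v j` clears it from the other vectors, the
    -- induction gives a dependency of the cleared vectors `u`, and the coefficient of the pivot is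
    -- solved for.
    linearDependency : ∀ (L : List A) {k} (v : Fin k → A → Carrier) → length L ℕ.< k →
      Σ[ c ∈ (Fin k → Carrier) ] ((∃[ i ] c i ≉ 0#) × (∀ {α} → α ∈ L → sum (λ i → c i * v i α) ≈ 0#))
    linearDependency []      {suc k} v _ = (λ _ → 1#) , (zero , 0≉1 ∘ sym) , λ ()
    linearDependency (α ∷ L) {suc k} v (s≤s L<k) with any? (λ i → ¬? (v i α ≟ 0#))
    ... | no vα≉0 with linearDependency L v (ℕ.m<n⇒m<1+n L<k)
    ...   | c , c≉0 , relation = c , c≉0 , λ where
            (here ≡.refl) → sum-zero λ i →
              trans (*-congˡ (decidable-stable (v i α ≟ 0#) λ vᵢα≉0 → vα≉0 (i , vᵢα≉0))) (zeroʳ (c i))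
            (there β∈L)   → relation β∈L
    linearDependency (α ∷ L) {suc k} v (s≤s L<k) | yes (j , vⱼα≉0)
      = c , (punchIn j i₀ , ≡.subst (_≉ 0#) (≡.sym (insertAt-punchIn c′ j cⱼ i₀)) c′ᵢ≉0) , λ where
          (here ≡.refl) → trans (elimination α) (sum-zero λ i →
            trans (*-congˡ (uα≈0 i)) (zeroʳ (c′ i)))
          (there β∈L)   → trans (elimination _) (relation β∈L)
      where
      open ≈-Reasoning
      r : Fin k → Carrier
      r i = v (punchIn j i) α * v j α ⁻¹
      u : Fin k → A → Carrier
      u i β = v (punchIn j i) β - r i * v j β
      uα≈0 : ∀ i → u i α ≈ 0#
      uα≈0 i = trans (+-congˡ (-‿cong (x*y*y⁻¹≈x _ vⱼα≉0))) (-‿inverseʳ _)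
      IH = linearDependency L u L<k
      c′ = proj₁ IH
      i₀ = proj₁ (proj₁ (proj₂ IH))
      c′ᵢ≉0 = proj₂ (proj₁ (proj₂ IH))
      relation = proj₂ (proj₂ IH)
      -- The pivot collects all that was subtracted in forming `u`, so that the combination of the
      -- `v i` equals that of the `u i` at every coordinate.
      cⱼ = sum (λ i → - (c′ i * r i))
      c = insertAt c′ j cⱼ
      elimination : ∀ β → sum (λ i → c i * v i β) ≈ sum (λ i → c′ i * u i β)
      elimination β = begin
        sum (λ i → c i * v i β)
          ≈⟨ sum-remove {i = j} (λ i → c i * v i β) ⟩
        c j * v j β + sum (λ i → c (punchIn j i) * v (punchIn j i) β)
          ≈⟨ +-cong (*-congʳ (reflexive (insertAt-lookup c′ j cⱼ)))
                    (sum-cong-≋ λ i → *-congʳ (reflexive (insertAt-punchIn c′ j cⱼ i))) ⟩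
        cⱼ * v j β + sum (λ i → c′ i * v (punchIn j i) β)
          ≈⟨ +-comm _ _ ⟩
        sum (λ i → c′ i * v (punchIn j i) β) + cⱼ * v j β
          ≈⟨ +-congˡ (*-distribʳ-sum (v j β) (λ i → - (c′ i * r i))) ⟩
        sum (λ i → c′ i * v (punchIn j i) β) + sum (λ i → - (c′ i * r i) * v j β)
          ≈⟨ ∑-distrib-+ (λ i → c′ i * v (punchIn j i) β) (λ i → - (c′ i * r i) * v j β) ⟨
        sum (λ i → c′ i * v (punchIn j i) β + - (c′ i * r i) * v j β)
          ≈⟨ sum-cong-≋ (λ i → x*[y-z*w]≈x*y-x*z*w (c′ i) _ (r i) (v j β)) ⟨
        sum (λ i → c′ i * u i β) ∎

    -- A dependency may be negated. A positive entry is what makes the minimum in the ratio test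
    -- range over a nonempty set.
    positiveDependency : ∀ (L : List A) {k} (v : Fin k → A → Carrier) → length L ℕ.< k →
      Σ[ c ∈ (Fin k → Carrier) ] ((∃[ i ] 0# < c i) × (∀ {α} → α ∈ L → sum (λ i → c i * v i α) ≈ 0#))
    positiveDependency L v L<k with linearDependency L v L<k
    ... | c , (i , cᵢ≉0) , relation with total 0# (c i)
    ...   | inj₁ 0≤cᵢ = c , (i , 0≤cᵢ , cᵢ≉0 ∘ sym) , relation
    ...   | inj₂ cᵢ≤0 = -_ ∘ c , (i , x≤0⇒0≤-x cᵢ≤0 , -cᵢ≉0) , λ {α} α∈L → begin
            sum (λ i → - c i * v i α)           ≈⟨ sum-cong-≋ (λ i → -1*[] (c i) (v i α)) ⟩
            sum (λ i → - 1# * (c i * v i α))    ≈⟨ *-distribˡ-sum (- 1#) (λ i → c i * v i α) ⟨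
            - 1# * sum (λ i → c i * v i α)      ≈⟨ *-congˡ (relation α∈L) ⟩
            - 1# * 0#                           ≈⟨ zeroʳ (- 1#) ⟩
            0#                                  ∎
      where
      open ≈-Reasoning
      -cᵢ≉0 : 0# ≉ - c i
      -cᵢ≉0 0≈-cᵢ = cᵢ≉0 (trans (sym (-‿involutive (c i))) (trans (-‿cong (sym 0≈-cᵢ)) -0#≈0#))
      -1*[] : ∀ x y → - x * y ≈ - 1# * (x * y)
      -1*[] x y = trans (sym (-‿distribˡ-* x y))
        (trans (-‿cong (sym (*-identityˡ (x * y)))) (-‿distribˡ-* 1# (x * y)))

    -- One step of the ratio test of the simplex method.
    dropOne : ∀ (L : List A) {k} (v : Fin (suc k) → A → Carrier) (μ : Fin (suc k) → Carrier) →
      (∀ i → 0# ≤ μ i) → length L ℕ.< suc k →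
      Σ[ j ∈ Fin (suc k) ] Σ[ μ′ ∈ (Fin k → Carrier) ] ((∀ i → 0# ≤ μ′ i) × (∀ {α} → α ∈ L →
        sum (λ i → μ′ i * v (punchIn j i) α) ≈ sum (λ i → μ i * v i α)))
    dropOne L {k} v μ μ≥0 L<k = j , μ′ ∘ punchIn j , μ′≥0 ∘ punchIn j , combination-preserved
      where
      open Extrema ≤-totalOrder using (argmin; argmin-all; f[argmin]≤f[xs])
      dependency = positiveDependency L v L<k
      c = proj₁ dependency
      i₀ = proj₁ (proj₁ (proj₂ dependency))
      0<cᵢ₀ = proj₂ (proj₁ (proj₂ dependency))
      relation = proj₂ (proj₂ dependency)
      positives : List (Fin (suc k))
      positives = filter (λ i → 0# <? c i) (allFin (suc k))
      ratio : Fin (suc k) → Carrier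
      ratio i = μ i * c i ⁻¹
      -- The least ratio is the largest multiple of the dependency that can be subtracted before a
      -- weight turns negative, and the weight attaining it becomes zero. The default `i₀` of
      -- `argmin` is itself an index with positive coefficient.
      j = argmin ratio i₀ positives
      ρ = ratio j
      0<cⱼ : 0# < c j
      0<cⱼ = argmin-all ratio {P = λ i → 0# < c i} 0<cᵢ₀ (all-filter (λ i → 0# <? c i) (allFin (suc k)))
      ρ-least : ∀ i → 0# < c i → ρ ≤ ratio i
      ρ-least i 0<cᵢ = All.lookup (f[argmin]≤f[xs] {f = ratio} i₀ positives)
                                  (∈-filter⁺ (λ i → 0# <? c i) (∈-allFin i) 0<cᵢ)
      ρ≥0 : 0# ≤ ρ
      ρ≥0 = *-nonNeg (μ≥0 j) (⁻¹-nonNeg 0<cⱼ)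
      μ′ : Fin (suc k) → Carrier
      μ′ i = μ i - ρ * c i
      μ′ⱼ≈0 : μ′ j ≈ 0#
      μ′ⱼ≈0 = trans (+-congˡ (-‿cong (x*y*y⁻¹≈x (μ j) (proj₂ 0<cⱼ ∘ sym)))) (-‿inverseʳ (μ j))
      ρcᵢ≤μᵢ : ∀ i → ρ * c i ≤ μ i
      ρcᵢ≤μᵢ i with 0# <? c i
      ... | no 0≮cᵢ  = ≤-trans (*-nonNeg-nonPos ρ≥0 (≮⇒≥ 0≮cᵢ)) (μ≥0 i)
      ... | yes 0<cᵢ = begin
        ρ * c i        ≈⟨ *-comm ρ (c i) ⟩
        c i * ρ        ≤⟨ *-monoˡ-≤ (proj₁ 0<cᵢ) (ρ-least i 0<cᵢ) ⟩
        c i * ratio i  ≈⟨ *-comm (c i) (ratio i) ⟩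
        ratio i * c i  ≈⟨ x*y*y⁻¹≈x (μ i) (proj₂ 0<cᵢ ∘ sym) ⟩
        μ i            ∎
        where open ≤-Reasoning
      μ′≥0 : ∀ i → 0# ≤ μ′ i
      μ′≥0 i = x≤y⇒0≤y-x (ρcᵢ≤μᵢ i)
      expand : ∀ α i → μ′ i * v i α ≈ μ i * v i α + - ρ * (c i * v i α)
      expand α i = begin
        (μ i - ρ * c i) * v i α            ≈⟨ distribʳ (v i α) (μ i) (- (ρ * c i)) ⟩
        μ i * v i α + - (ρ * c i) * v i α  ≈⟨ +-congˡ (*-congʳ (-‿distribˡ-* ρ (c i))) ⟩
        μ i * v i α + - ρ * c i * v i α    ≈⟨ +-congˡ (*-assoc (- ρ) (c i) (v i α)) ⟩
        μ i * v i α + - ρ * (c i * v i α)  ∎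
        where open ≈-Reasoning
      combination-preserved : ∀ {α} → α ∈ L →
        sum (λ i → μ′ (punchIn j i) * v (punchIn j i) α) ≈ sum (λ i → μ i * v i α)
      combination-preserved {α} α∈L = begin
        sum (λ i → μ′ (punchIn j i) * v (punchIn j i) α)
          ≈⟨ +-identityˡ _ ⟨
        0# + sum (λ i → μ′ (punchIn j i) * v (punchIn j i) α)
          ≈⟨ +-congʳ (trans (*-congʳ μ′ⱼ≈0) (zeroˡ (v j α))) ⟨
        μ′ j * v j α + sum (λ i → μ′ (punchIn j i) * v (punchIn j i) α)
          ≈⟨ sum-remove {i = j} (λ i → μ′ i * v i α) ⟨
        sum (λ i → μ′ i * v i α)
          ≈⟨ sum-cong-≋ (expand α) ⟩
        sum (λ i → μ i * v i α + - ρ * (c i * v i α))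
          ≈⟨ ∑-distrib-+ (λ i → μ i * v i α) (λ i → - ρ * (c i * v i α)) ⟩
        sum (λ i → μ i * v i α) + sum (λ i → - ρ * (c i * v i α))
          ≈⟨ +-congˡ (*-distribˡ-sum (- ρ) (λ i → c i * v i α)) ⟨
        sum (λ i → μ i * v i α) + - ρ * sum (λ i → c i * v i α)
          ≈⟨ +-congˡ (trans (*-congˡ (relation α∈L)) (zeroʳ (- ρ))) ⟩
        sum (λ i → μ i * v i α) + 0#
          ≈⟨ +-identityʳ _ ⟩
        sum (λ i → μ i * v i α) ∎
        where open ≈-Reasoning

    -- Vectors are dropped while they outnumber the coordinates. The map `σ` records which of them
    -- survive: they are reused unchanged, so whatever is attached to them (circuit, factors, degree
    -- bound) survives too, and only the weights are new.
    conicCarathéodory : ∀ (L : List A) {k} (v : Fin k → A → Carrier) (μ : Fin k → Carrier) →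
      (∀ i → 0# ≤ μ i) →
      ∃[ l ] Σ[ σ ∈ (Fin l → Fin k) ] Σ[ μ′ ∈ (Fin l → Carrier) ] (l ℕ.≤ length L × (∀ i → 0# ≤ μ′ i) × (∀ {α} → α ∈ L →
        sum (λ i → μ′ i * v (σ i) α) ≈ sum (λ i → μ i * v i α)))
    conicCarathéodory L {zero}  v μ μ≥0 = zero , id , μ , z≤n , μ≥0 , λ _ → refl
    conicCarathéodory L {suc k} v μ μ≥0 with suc k ℕ.≤? length L
    ... | yes k≤L = suc k , id , μ , k≤L , μ≥0 , λ _ → refl
    ... | no k≰L =
      let j , μ₁ , μ₁≥0 , eq₁ = dropOne L v μ μ≥0 (ℕ.≰⇒> k≰L)
          l , σ , μ₂ , l≤L , μ₂≥0 , eq₂ = conicCarathéodory L (v ∘ punchIn j) μ₁ μ₁≥0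
      in l , punchIn j ∘ σ , μ₂ , l≤L , μ₂≥0 , λ α∈L → trans (eq₂ α∈L) (eq₁ α∈L)

-- Polynomials as functionals, supports and products

module Polynomials (𝓡 : CompleteOrderedField) where

  open CompleteOrderedField 𝓡 hiding (zero)
  open SONC 𝓡
  open OrderedField 𝓡
  open import Algebra.Properties.Semiring.Exp semiring using (^-homo-*; ^-assocʳ)
  open import Algebra.Properties.CommutativeSemigroup +-commutativeSemigroup
    using () renaming (interchange to +-interchange; x∙yz≈y∙xz to +-swap)
  open import Algebra.Properties.CommutativeSemigroup *-commutativeSemigroup
    using () renaming (x∙yz≈y∙xz to *-swap)

  infixl 6 _+ᵉ_
  _+ᵉ_ : ∀ {n} → Exponent n → Exponent n → Exponent n
  _+ᵉ_ = Vec.zipWith ℕ._+_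

  infix 4 _≟ᵉ_
  _≟ᵉ_ : ∀ {n} (α β : Exponent n) → Dec (α ≡ β)
  _≟ᵉ_ = Vec.≡-dec ℕ._≟_

  indicator : ∀ {n} → Exponent n → Exponent n → ℝ
  indicator α β = if does (β ≟ᵉ α) then 1# else 0#

  indicator-≡ : ∀ {n} {α β : Exponent n} → β ≡ α → indicator α β ≡ 1#
  indicator-≡ {α = α} {β} β≡α rewrite dec-true (β ≟ᵉ α) β≡α = ≡.refl

  indicator-≢ : ∀ {n} {α β : Exponent n} → β ≢ α → indicator α β ≡ 0#
  indicator-≢ {α = α} {β} β≢α rewrite dec-false (β ≟ᵉ α) β≢α = ≡.refl

  -- The linear functional on polynomials that sends x^α to F α; it subsumes
  -- coefficients (F an indicator) and evaluation (F = monomialAt x).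
  pair : ∀ {n} → Poly n → (Exponent n → ℝ) → ℝ
  pair []            F = 0#
  pair ((c , α) ∷ p) F = c * F α + pair p F

  coeff≈pair : ∀ {n} (p : Poly n) α → coeff p α ≈ pair p (indicator α)
  coeff≈pair []            α = refl
  coeff≈pair ((c , β) ∷ p) α with β ≟ᵉ α
  ... | yes _ = +-cong (sym (*-identityʳ c)) (coeff≈pair p α)
  ... | no _  = trans (coeff≈pair p α) (sym (trans (+-congʳ (zeroʳ c)) (+-identityˡ _)))

  eval≈pair : ∀ {n} (p : Poly n) x → eval p x ≈ pair p (monomialAt x)
  eval≈pair []            x = refl
  eval≈pair ((c , β) ∷ p) x = +-congˡ (eval≈pair p x)

  pair-cong : ∀ {n} (p : Poly n) {F G} → (∀ α → F α ≈ G α) → pair p F ≈ pair p G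
  pair-cong []            F≈G = refl
  pair-cong ((c , α) ∷ p) F≈G = +-cong (*-congˡ (F≈G α)) (pair-cong p F≈G)

  pair-+ : ∀ {n} (p : Poly n) F G → pair p (λ α → F α + G α) ≈ pair p F + pair p G
  pair-+ []            F G = sym (+-identityˡ 0#)
  pair-+ ((c , α) ∷ p) F G = trans (+-cong (distribˡ c (F α) (G α)) (pair-+ p F G))
                                   (+-interchange _ _ _ _)

  pair-* : ∀ {n} (p : Poly n) e F → pair p (λ α → e * F α) ≈ e * pair p F
  pair-* []            e F = sym (zeroʳ e)
  pair-* ((c , α) ∷ p) e F = trans (+-cong (*-swap c e (F α)) (pair-* p e F)) (sym (distribˡ e _ _))

  pair-++ : ∀ {n} (p q : Poly n) F → pair (p ++ q) F ≈ pair p F + pair q F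
  pair-++ []            q F = sym (+-identityˡ _)
  pair-++ ((c , α) ∷ p) q F = trans (+-congˡ (pair-++ p q F)) (sym (+-assoc _ _ _))

  pair-⊙ : ∀ {n} c (p : Poly n) F → pair (c ⊙ p) F ≈ c * pair p F
  pair-⊙ c []            F = sym (zeroʳ c)
  pair-⊙ c ((e , α) ∷ p) F = trans (+-cong (*-assoc c e (F α)) (pair-⊙ c p F)) (sym (distribˡ c _ _))

  pair-⊗ : ∀ {n} (p q : Poly n) F → pair (p ⊗ q) F ≈ pair p (λ α → pair q (λ β → F (α +ᵉ β)))
  pair-⊗ []            q F = refl
  pair-⊗ ((c , α) ∷ p) q F = trans (pair-++ (map _ q) (p ⊗ q) F) (+-cong (pair-term q) (pair-⊗ p q F))
    where
    pair-term : ∀ q → pair (map (λ (e , β) → c * e , α +ᵉ β) q) F ≈ c * pair q (λ β → F (α +ᵉ β))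
    pair-term []            = sym (zeroʳ c)
    pair-term ((e , β) ∷ q) = trans (+-cong (*-assoc c e _) (pair-term q)) (sym (distribˡ c _ _))

  pair-zero : ∀ {n} (p : Poly n) → pair p (λ _ → 0#) ≈ 0#
  pair-zero []            = refl
  pair-zero ((c , α) ∷ p) = trans (+-cong (zeroʳ c) (pair-zero p)) (+-identityˡ 0#)

  Support : ∀ {n} → Poly n → Exponent n → Set
  Support p α = coeff p α ≉ 0#

  support? : ∀ {n} (p : Poly n) α → Dec (Support p α)
  support? p α = ¬? (coeff p α ≟ 0#)

  exponents : ∀ {n} → Poly n → List (Exponent n)
  exponents = map proj₂

  support⇒∈ : ∀ {n} (p : Poly n) {α} → Support p α → α ∈ exponents p
  support⇒∈ []            {α} cα≉0 = contradiction refl cα≉0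
  support⇒∈ ((c , β) ∷ p) {α} cα≉0 with β ≟ᵉ α
  ... | yes ≡.refl = here ≡.refl
  ... | no _       = there (support⇒∈ p cα≉0)

  remove : ∀ {n} → Exponent n → Poly n → Poly n
  remove α = filter (λ (_ , β) → ¬? (β ≟ᵉ α))

  pair-remove : ∀ {n} α (p : Poly n) F → pair p F ≈ coeff p α * F α + pair (remove α p) F
  pair-remove α []            F = sym (trans (+-identityʳ _) (zeroˡ (F α)))
  pair-remove α ((c , β) ∷ p) F with β ≟ᵉ α
  ... | yes ≡.refl = begin
    c * F α + pair p F                                     ≈⟨ +-congˡ (pair-remove α p F) ⟩
    c * F α + (coeff p α * F α + pair (remove α p) F)      ≈⟨ +-assoc _ _ _ ⟨
    c * F α + coeff p α * F α + pair (remove α p) F        ≈⟨ +-congʳ (distribʳ (F α) c _) ⟨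
    (c + coeff p α) * F α + pair (remove α p) F            ∎
    where open ≈-Reasoning
  ... | no _       = trans (+-congˡ (pair-remove α p F)) (+-swap _ _ _)

  support-remove : ∀ {n} α (p : Poly n) {β} → Support (remove α p) β → Support p β
  support-remove α p {β} cβ′≉0 cβ≈0 with α ≟ᵉ β
  ... | yes ≡.refl = cβ′≉0 (begin
    coeff (remove α p) α                                       ≈⟨ coeff≈pair (remove α p) α ⟩
    pair (remove α p) (indicator α)                            ≈⟨ +-identityˡ _ ⟨
    0# + pair (remove α p) (indicator α)                       ≈⟨ +-congʳ (zeroˡ (indicator α α)) ⟨
    0# * indicator α α + pair (remove α p) (indicator α)       ≈⟨ +-congʳ (*-congʳ cβ≈0) ⟨
    coeff p α * indicator α α + pair (remove α p) (indicator α) ≈⟨ pair-remove α p (indicator α) ⟨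
    pair p (indicator α)                                       ≈⟨ coeff≈pair p α ⟨
    coeff p α                                                  ≈⟨ cβ≈0 ⟩
    0#                                                         ∎)
    where open ≈-Reasoning
  ... | no α≢β    = cβ′≉0 (begin
    coeff (remove α p) β                                       ≈⟨ coeff≈pair (remove α p) β ⟩
    pair (remove α p) (indicator β)                            ≈⟨ +-identityˡ _ ⟨
    0# + pair (remove α p) (indicator β)                       ≈⟨ +-congʳ (zeroʳ (coeff p α)) ⟨
    coeff p α * 0# + pair (remove α p) (indicator β)           ≈⟨ +-congʳ (*-congˡ (reflexive (indicator-≢ α≢β))) ⟨
    coeff p α * indicator β α + pair (remove α p) (indicator β) ≈⟨ pair-remove α p (indicator β) ⟨
    pair p (indicator β)                                       ≈⟨ coeff≈pair p β ⟨
    coeff p β                                                  ≈⟨ cβ≈0 ⟩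
    0#                                                         ∎)
    where open ≈-Reasoning

  -- Terms with a repeated exponent may cancel, so a listed exponent need not lie in the support and
  -- a comparison term by term fails. Hence all terms at `α` are first collected into
  -- `coeff p α * F α`, which is zero outside the support.
  pair-cong-support : ∀ {n} (p : Poly n) {F G} → (∀ α → Support p α → F α ≈ G α) → pair p F ≈ pair p G
  pair-cong-support {n} p = byExponents (exponents p) p (∈-map⁺ proj₂)
    where
    -- The induction runs over a list covering the exponents, because `remove α p` is not a
    -- structural part of `p`.
    byExponents : ∀ (L : List (Exponent n)) p → (∀ {t} → t ∈ p → proj₂ t ∈ L) →
                  ∀ {F G} → (∀ α → Support p α → F α ≈ G α) → pair p F ≈ pair p G
    byExponents []      []      p⊆L F≈G = refl
    byExponents []      (t ∷ p) p⊆L F≈G with () ← p⊆L (here ≡.refl)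
    byExponents (α ∷ L) p       p⊆L {F} {G} F≈G = begin
      pair p F                                ≈⟨ pair-remove α p F ⟩
      coeff p α * F α + pair (remove α p) F   ≈⟨ +-cong agree (byExponents L (remove α p) removed⊆L
                                                   λ β → F≈G β ∘ support-remove α p) ⟩
      coeff p α * G α + pair (remove α p) G   ≈⟨ pair-remove α p G ⟨
      pair p G                                ∎
      where
      open ≈-Reasoning
      agree : coeff p α * F α ≈ coeff p α * G α
      agree with coeff p α ≟ 0#
      ... | no c≉0  = *-congˡ (F≈G α c≉0)
      ... | yes c≈0 = trans (trans (*-congʳ c≈0) (zeroˡ (F α))) (sym (trans (*-congʳ c≈0) (zeroˡ (G α))))
      removed⊆L : ∀ {t} → t ∈ remove α p → proj₂ t ∈ L
      removed⊆L t∈ with t∈p , β≢α ← ∈-filter⁻ (λ (_ , β) → ¬? (β ≟ᵉ α)) t∈ with p⊆L t∈p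
      ... | here β≡α  = contradiction β≡α β≢α
      ... | there β∈L = β∈L

  pair-vanishing : ∀ {n} (p : Poly n) {F} → (∀ α → Support p α → F α ≈ 0#) → pair p F ≈ 0#
  pair-vanishing p F≈0 = trans (pair-cong-support p F≈0) (pair-zero p)

  coeff-⊗ : ∀ {n} (p q : Poly n) γ →
            coeff (p ⊗ q) γ ≈ pair p (λ α → pair q (λ β → indicator γ (α +ᵉ β)))
  coeff-⊗ p q γ = trans (coeff≈pair (p ⊗ q) γ) (pair-⊗ p q (indicator γ))

  -- On the two supports uniqueness turns the indicator of `α +ᵉ β` into a product of two
  -- indicators, and the double sum separates.
  coeff-⊗-unique : ∀ {n} (p q : Poly n) {α β} →
    (∀ {α′ β′} → Support p α′ → Support q β′ → α′ +ᵉ β′ ≡ α +ᵉ β → α′ ≡ α × β′ ≡ β) →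
    coeff (p ⊗ q) (α +ᵉ β) ≈ coeff p α * coeff q β
  coeff-⊗-unique p q {α} {β} unique = begin
    coeff (p ⊗ q) (α +ᵉ β)
      ≈⟨ coeff-⊗ p q (α +ᵉ β) ⟩
    pair p (λ α′ → pair q (λ β′ → indicator (α +ᵉ β) (α′ +ᵉ β′)))
      ≈⟨ pair-cong-support p (λ α′ α′∈p → pair-cong-support q λ β′ β′∈q → factorise α′ β′ α′∈p β′∈q) ⟩
    pair p (λ α′ → pair q (λ β′ → indicator α α′ * indicator β β′))
      ≈⟨ pair-cong p (λ α′ → trans (pair-* q (indicator α α′) (indicator β)) (*-comm _ _)) ⟩
    pair p (λ α′ → pair q (indicator β) * indicator α α′)
      ≈⟨ pair-* p (pair q (indicator β)) (indicator α) ⟩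
    pair q (indicator β) * pair p (indicator α)
      ≈⟨ *-cong (coeff≈pair q β) (coeff≈pair p α) ⟨
    coeff q β * coeff p α
      ≈⟨ *-comm _ _ ⟩
    coeff p α * coeff q β ∎
    where
    open ≈-Reasoning
    factorise : ∀ α′ β′ → Support p α′ → Support q β′ →
                indicator (α +ᵉ β) (α′ +ᵉ β′) ≈ indicator α α′ * indicator β β′
    factorise α′ β′ α′∈p β′∈q with α′ ≟ᵉ α | β′ ≟ᵉ β
    ... | yes ≡.refl | yes ≡.refl = trans (reflexive (indicator-≡ {α = α +ᵉ β} ≡.refl)) (sym (*-identityˡ 1#))
    ... | yes _      | no β′≢β    = trans
      (reflexive (indicator-≢ (β′≢β ∘ proj₂ ∘ unique α′∈p β′∈q))) (sym (zeroʳ _))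
    ... | no α′≢α    | _          = trans
      (reflexive (indicator-≢ (α′≢α ∘ proj₁ ∘ unique α′∈p β′∈q))) (sym (zeroˡ _))

  degree-⊗ : ∀ {n d} (p q : Poly n) →
    (∀ {α β} → Support p α → Support q β → ∣ α +ᵉ β ∣ ℕ.≤ d) → DegreeAtMost d (p ⊗ q)
  degree-⊗ {d = d} p q bound γ cγ≉0 = decidable-stable (∣ γ ∣ ℕ.≤? d) λ γ≰d →
    cγ≉0 (trans (coeff-⊗ p q γ) (pair-vanishing p λ α α∈p → pair-vanishing q λ β β∈q →
      reflexive (indicator-≢ {α = γ} {α +ᵉ β} λ α+β≡γ → γ≰d (≡.subst (λ δ → ∣ δ ∣ ℕ.≤ d) α+β≡γ (bound α∈p β∈q)))))

  -- Signs of leading coefficients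

  -- `M` is the sum of the nonnegative listed coefficients; the other terms can only lower the
  -- pairing. It depends neither on `G` nor on `U`, so the point of evaluation can be chosen after
  -- it.
  pair-bounded : ∀ {n} (p : Poly n) → Σ[ M ∈ ℝ ] (0# ≤ M × (∀ G U → (∀ α → 0# ≤ G α) → (∀ α → G α ≤ U) →
                                                    pair p G ≤ M * U))
  pair-bounded []            = 0# , ≤-refl , λ G U _ _ → ≤-reflexive (sym (zeroˡ U))
  pair-bounded ((c , α) ∷ p) with pair-bounded p | total 0# c
  ... | M , 0≤M , bound | inj₁ 0≤c = c + M , +-nonNeg 0≤c 0≤M , λ G U 0≤G G≤U →
        ≤-trans (+-mono-≤ (*-monoˡ-≤ 0≤c (G≤U α)) (bound G U 0≤G G≤U)) (≤-reflexive (sym (distribʳ U c M)))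
  ... | M , 0≤M , bound | inj₂ c≤0 = M , 0≤M , λ G U 0≤G G≤U →
        ≤-trans (+-mono-≤ (≤-trans (≤-reflexive (*-comm c (G α))) (*-nonNeg-nonPos (0≤G α) c≤0))
                          (bound G U 0≤G G≤U))
                (≤-reflexive (+-identityˡ _))

  monomialAt-powers : ∀ {n} T (w : Fin n → ℕ) α → monomialAt (λ i → T ^ w i) α ≈ T ^ weight w α
  monomialAt-powers T w Vec.[]      = refl
  monomialAt-powers T w (k Vec.∷ α) =
    trans (*-cong (^-assocʳ T (w zero) k) (monomialAt-powers T (w ∘ suc) α))
          (sym (^-homo-* T (w zero ℕ.* k) (weight (w ∘ suc) α)))

  1≤^ : ∀ {T} → 1# ≤ T → ∀ k → 1# ≤ T ^ k
  1≤^ 1≤T zero    = ≤-refl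
  1≤^ {T} 1≤T (suc k) = begin
    1#          ≤⟨ 1≤T ⟩
    T           ≈⟨ *-identityʳ T ⟨
    T * 1#      ≤⟨ *-monoˡ-≤ (≤-trans 0≤1 1≤T) (1≤^ 1≤T k) ⟩
    T * T ^ k   ∎
    where open ≤-Reasoning

  ^-monoʳ-≤ : ∀ {T} → 1# ≤ T → ∀ {k l} → k ℕ.≤ l → T ^ k ≤ T ^ l
  ^-monoʳ-≤ 1≤T {l = l} z≤n = 1≤^ 1≤T l
  ^-monoʳ-≤ 1≤T (s≤s k≤l)   = *-monoˡ-≤ (≤-trans 0≤1 1≤T) (^-monoʳ-≤ 1≤T k≤l)

  -- `α` may lie outside the support, its coefficient then being 0. The common leading exponent of
  -- several circuits is in this position for each circuit in which it does not occur.
  Leading : ∀ {n} → (Fin n → ℕ) → Poly n → Exponent n → Set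
  Leading w p α = ∀ β → Support p β → β ≡ α ⊎ weight w β ℕ.< weight w α

  -- Along the curve xᵢ = T^wᵢ the leading term dominates as T grows.
  leadingCoeff-nonNeg : ∀ {n} (w : Fin n → ℕ) (p : Poly n) → NonNegative p →
                        ∀ α → Leading w p α → 0# ≤ coeff p α
  leadingCoeff-nonNeg w p p≥0 α leading = decidable-stable (0# ≤? coeff p α) negative⇒⊥
    where
    c = coeff p α
    M = proj₁ (pair-bounded p)
    0≤M = proj₁ (proj₂ (pair-bounded p))
    bound = proj₂ (proj₂ (pair-bounded p))
    negative⇒⊥ : ¬ ¬ (0# ≤ c)
    negative⇒⊥ 0≰c = *-≉0 (λ e≈0 → 0≉1 (antisym 0≤1 (≤-trans 1≤e (≤-reflexive e≈0)))) c≉0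
                          (antisym (*-nonNeg-nonPos 0≤e c≤0) 0≤ec)
      where
      c≤0 : c ≤ 0#
      c≤0 with total 0# c
      ... | inj₁ 0≤c = contradiction 0≤c 0≰c
      ... | inj₂ c≤0 = c≤0
      c≉0 : c ≉ 0#
      c≉0 c≈0 = 0≰c (≤-reflexive (sym c≈0))
      0<-c : 0# < - c
      0<-c = x≤0⇒0≤-x c≤0 , λ 0≈-c →
        c≉0 (trans (sym (-‿involutive c)) (trans (-‿cong (sym 0≈-c)) -0#≈0#))
      -- `T = 1 + M / (- c)` solves `T * c + M = c`, so a single explicit point of the curve gives
      -- the contradiction and no limit is taken.
      δ = M * (- c) ⁻¹
      0≤δ : 0# ≤ δ
      0≤δ = *-nonNeg 0≤M (⁻¹-nonNeg 0<-c)
      T = 1# + δ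
      1≤T : 1# ≤ T
      1≤T = ≤-trans (≤-reflexive (sym (+-identityʳ 1#))) (+-mono-≤ ≤-refl 0≤δ)
      Tc+M≈c : T * c + M ≈ c
      Tc+M≈c = begin
        T * c + M                    ≈⟨ +-cong (distribʳ c 1# δ) (sym (x*y*y⁻¹≈x M (proj₂ 0<-c ∘ sym))) ⟩
        1# * c + δ * c + δ * - c     ≈⟨ +-assoc _ _ _ ⟩
        1# * c + (δ * c + δ * - c)   ≈⟨ +-cong (*-identityˡ c) (sym (distribˡ δ c (- c))) ⟩
        c + δ * (c - c)              ≈⟨ +-congˡ (trans (*-congˡ (-‿inverseʳ c)) (zeroʳ δ)) ⟩
        c + 0#                       ≈⟨ +-identityʳ c ⟩
        c                            ∎
        where open ≈-Reasoning
      e = T ^ weight w α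
      1≤e : 1# ≤ e
      1≤e = 1≤^ 1≤T (weight w α)
      0≤e : 0# ≤ e
      0≤e = ≤-trans 0≤1 1≤e
      0≤T = ≤-trans 0≤1 1≤T
      lower? : ∀ β → Dec (weight w β ℕ.< weight w α)
      lower? β = weight w β ℕ.<? weight w α
      -- The part of lower weight on the curve. Natural weights that differ do so by at least one,
      -- so `T * G β` is still at most `e`; for this reason the value of `p` is multiplied by `T` in
      -- `0≤ec`.
      G : Exponent _ → ℝ
      G β = if does (lower? β) then T ^ weight w β else 0#
      0≤TG : ∀ β → 0# ≤ T * G β
      0≤TG β = go (lower? β)
        where
        go : (β<α? : Dec (weight w β ℕ.< weight w α)) →
             0# ≤ T * (if does β<α? then T ^ weight w β else 0#)
        go (yes _) = *-nonNeg 0≤T (≤-trans 0≤1 (1≤^ 1≤T (weight w β)))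
        go (no _)  = *-nonNeg 0≤T ≤-refl
      TG≤e : ∀ β → T * G β ≤ e
      TG≤e β = go (lower? β)
        where
        go : (β<α? : Dec (weight w β ℕ.< weight w α)) →
             T * (if does β<α? then T ^ weight w β else 0#) ≤ e
        go (yes β<α) = ^-monoʳ-≤ 1≤T β<α
        go (no _)    = ≤-trans (≤-reflexive (zeroʳ T)) 0≤e
      split : ∀ β → Support p β → monomialAt (λ i → T ^ w i) β ≈ e * indicator α β + G β
      split β β∈p with leading β β∈p
      ... | inj₁ ≡.refl rewrite indicator-≡ {α = α} ≡.refl | dec-false (lower? α) (ℕ.<-irrefl ≡.refl) =
        trans (monomialAt-powers T w α) (sym (trans (+-identityʳ _) (*-identityʳ e)))
      ... | inj₂ β<α rewrite indicator-≢ {α = α} {β} (λ β≡α → ℕ.<-irrefl (≡.cong (weight w) β≡α) β<α)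
                           | dec-true (lower? β) β<α =
        trans (monomialAt-powers T w β) (sym (trans (+-congʳ (zeroʳ e)) (+-identityˡ _)))
      value≈ : eval p (λ i → T ^ w i) ≈ e * c + pair p G
      value≈ = begin
        eval p (λ i → T ^ w i)                       ≈⟨ eval≈pair p _ ⟩
        pair p (monomialAt (λ i → T ^ w i))          ≈⟨ pair-cong-support p split ⟩
        pair p (λ β → e * indicator α β + G β)       ≈⟨ pair-+ p (λ β → e * indicator α β) G ⟩
        pair p (λ β → e * indicator α β) + pair p G  ≈⟨ +-congʳ (pair-* p e (indicator α)) ⟩
        e * pair p (indicator α) + pair p G          ≈⟨ +-congʳ (*-congˡ (coeff≈pair p α)) ⟨
        e * c + pair p G                             ∎
        where open ≈-Reasoning
      0≤ec : 0# ≤ e * c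
      0≤ec = begin
        0#                                    ≤⟨ *-nonNeg 0≤T (p≥0 (λ i → T ^ w i)) ⟩
        T * eval p (λ i → T ^ w i)            ≈⟨ *-congˡ value≈ ⟩
        T * (e * c + pair p G)                ≈⟨ distribˡ T _ _ ⟩
        T * (e * c) + T * pair p G            ≈⟨ +-cong (*-swap T e c) (sym (pair-* p T G)) ⟩
        e * (T * c) + pair p (λ β → T * G β)  ≤⟨ +-mono-≤ ≤-refl (bound _ e 0≤TG TG≤e) ⟩
        e * (T * c) + M * e                   ≈⟨ +-congˡ (*-comm M e) ⟩
        e * (T * c) + e * M                   ≈⟨ distribˡ e _ _ ⟨
        e * (T * c + M)                       ≈⟨ *-congˡ Tc+M≈c ⟩
        e * c                                 ∎
        where open ≤-Reasoning

  -- A monomial square comes without a proof of nonnegativity; its coefficients are read off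
  -- directly, each being `c` or 0.
  circuit-leadingCoeff-nonNeg : ∀ {n} (w : Fin n → ℕ) (p : Poly n) → IsNonNegativeCircuit p →
                                ∀ α → Leading w p α → 0# ≤ coeff p α
  circuit-leadingCoeff-nonNeg w p (inj₁ (_ , p≥0)) α leading = leadingCoeff-nonNeg w p p≥0 α leading
  circuit-leadingCoeff-nonNeg w p (inj₂ (c , β , 0<c , _ , p≋cxᵝ)) α _ =
    ≤-trans coeff≥0 (≤-reflexive (sym (p≋cxᵝ α)))
    where
    coeff≥0 : 0# ≤ coeff ((c , β) ∷ []) α
    coeff≥0 with β ≟ᵉ α
    ... | yes _ = +-nonNeg (proj₁ 0<c) ≤-refl
    ... | no _  = ≤-refl

maximal : ∀ {A : Set} (φ : A → ℕ) {Q : A → Set} (Q? : Decidable Q) (L : List A) →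
          (∀ {x} → Q x → x ∈ L) → ∀ {x₀} → Q x₀ →
          Σ[ x ∈ A ] (Q x × (∀ {y} → Q y → φ y ℕ.≤ φ x))
maximal φ Q? L Q⊆L {x₀} qx₀ = argmax φ x₀ xs , argmax-all φ qx₀ (all-filter Q? L) ,
  λ qy → All.lookup (f[xs]≤f[argmax] {f = φ} x₀ xs) (∈-filter⁺ Q? (Q⊆L qy) qy)
  where xs = filter Q? L

-- Sums over lists and coefficients of SONC polynomials

module Certificates (𝓡 : CompleteOrderedField) where

  open CompleteOrderedField 𝓡 hiding (zero)
  open SONC 𝓡
  open OrderedField 𝓡
  open Polynomials 𝓡
  open WeightedCircuit

  sumOver : ∀ {A : Set} → (A → ℝ) → List A → ℝ
  sumOver f = foldr (λ x acc → f x + acc) 0#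

  module _ {A : Set} {f : A → ℝ} where

    sumOver-zero : ∀ xs → (∀ {x} → x ∈ xs → f x ≈ 0#) → sumOver f xs ≈ 0#
    sumOver-zero []       f≈0 = refl
    sumOver-zero (x ∷ xs) f≈0 =
      trans (+-cong (f≈0 (here ≡.refl)) (sumOver-zero xs (f≈0 ∘ there))) (+-identityˡ 0#)

    sumOver-nonNeg : ∀ xs → (∀ {x} → x ∈ xs → 0# ≤ f x) → 0# ≤ sumOver f xs
    sumOver-nonNeg []       f≥0 = ≤-refl
    sumOver-nonNeg (x ∷ xs) f≥0 = +-nonNeg (f≥0 (here ≡.refl)) (sumOver-nonNeg xs (f≥0 ∘ there))

    -- Nonnegative numbers cannot cancel: each summand lies between 0 and the whole sum.
    sumOver-≉0 : ∀ xs → (∀ {x} → x ∈ xs → 0# ≤ f x) → Any (λ x → f x ≉ 0#) xs → sumOver f xs ≉ 0#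
    sumOver-≉0 (x ∷ xs) f≥0 (here fx≉0) Σ≈0 = fx≉0 (antisym (begin
      f x                    ≈⟨ +-identityʳ (f x) ⟨
      f x + 0#               ≤⟨ +-mono-≤ ≤-refl (sumOver-nonNeg xs (f≥0 ∘ there)) ⟩
      f x + sumOver f xs     ≈⟨ Σ≈0 ⟩
      0#                     ∎) (f≥0 (here ≡.refl)))
      where open ≤-Reasoning
    sumOver-≉0 (x ∷ xs) f≥0 (there f≉0) Σ≈0 = sumOver-≉0 xs (f≥0 ∘ there) f≉0 (antisym (begin
      sumOver f xs           ≈⟨ +-identityˡ _ ⟨
      0# + sumOver f xs      ≤⟨ +-mono-≤ (f≥0 (here ≡.refl)) ≤-refl ⟩
      f x + sumOver f xs     ≈⟨ Σ≈0 ⟩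
      0#                     ∎) (sumOver-nonNeg xs (f≥0 ∘ there)))
      where open ≤-Reasoning

    sumOver-++ : ∀ xs ys → sumOver f (xs ++ ys) ≈ sumOver f xs + sumOver f ys
    sumOver-++ []       ys = sym (+-identityˡ _)
    sumOver-++ (x ∷ xs) ys = trans (+-congˡ (sumOver-++ xs ys)) (sym (+-assoc _ _ _))

    sumOver≈sum-lookup : ∀ xs → sumOver f xs ≈ sum (f ∘ lookup xs)
    sumOver≈sum-lookup []       = refl
    sumOver≈sum-lookup (x ∷ xs) = +-congˡ (sumOver≈sum-lookup xs)

  coeff-++ : ∀ {n} (p q : Poly n) α → coeff (p ++ q) α ≈ coeff p α + coeff q α
  coeff-++ p q α = trans (coeff≈pair (p ++ q) α)
    (trans (pair-++ p q _) (sym (+-cong (coeff≈pair p α) (coeff≈pair q α))))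

  pair-⟦⟧ : ∀ {n} (s : SONCPoly n) F → pair ⟦ s ⟧ F ≈ sumOver (λ t → μ t * pair (q t) F) s
  pair-⟦⟧ []      F = refl
  pair-⟦⟧ (t ∷ s) F = trans (pair-++ (μ t ⊙ q t) ⟦ s ⟧ F) (+-cong (pair-⊙ (μ t) (q t) F) (pair-⟦⟧ s F))

  sumOver-cong : ∀ {A : Set} {f g : A → ℝ} → (∀ x → f x ≈ g x) → ∀ xs → sumOver f xs ≈ sumOver g xs
  sumOver-cong f≈g []       = refl
  sumOver-cong f≈g (x ∷ xs) = +-cong (f≈g x) (sumOver-cong f≈g xs)

  coeff-⟦⟧ : ∀ {n} (s : SONCPoly n) α → coeff ⟦ s ⟧ α ≈ sumOver (λ t → μ t * coeff (q t) α) s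
  coeff-⟦⟧ s α = trans (coeff≈pair ⟦ s ⟧ α) (trans (pair-⟦⟧ s _)
    (sumOver-cong (λ t → *-congˡ (sym (coeff≈pair (q t) α))) s))

  coeff-⟦⟧⊗ : ∀ {n} (s : SONCPoly n) (h : Poly n) α →
              coeff (⟦ s ⟧ ⊗ h) α ≈ sumOver (λ t → μ t * coeff (q t ⊗ h) α) s
  coeff-⟦⟧⊗ s h α = trans (coeff-⊗ ⟦ s ⟧ h α) (trans (pair-⟦⟧ s _)
    (sumOver-cong (λ t → *-congˡ (sym (coeff-⊗ (q t) h α))) s))

  -- No cancellation among the circuits of one summand

  module NoCancellation {n d} (s : SONCPoly n) (h : Poly n) (deg : DegreeAtMost d (⟦ s ⟧ ⊗ h)) where

    -- Circuits of weight zero are excluded: they leave no trace in `⟦ s ⟧`, so `deg` carries no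
    -- information about them.
    Contributes : Exponent n → WeightedCircuit n → Set
    Contributes α t = μ t ≉ 0# × Support (q t) α

    contributes? : ∀ α → Decidable (Contributes α)
    contributes? α t = ¬? (μ t ≟ 0#) ×-dec support? (q t) α

    -- The union of the supports of the contributing circuits. It may exceed the support of `⟦ s ⟧`,
    -- and the excess is what has to be bounded.
    Occurs : Exponent n → Set
    Occurs α = Any (Contributes α) s

    occurs? : Decidable Occurs
    occurs? α = Any.any? (contributes? α) s

    circuitExponents : List (Exponent n)
    circuitExponents = concatMap (exponents ∘ q) s

    occurs⇒∈ : ∀ {α} → Occurs α → α ∈ circuitExponents
    occurs⇒∈ = ∈-concatMap⁺ (exponents ∘ q) ∘ Any.map (λ {t} (_ , α∈q) → support⇒∈ (q t) α∈q)

    support⇒occurs : ∀ {α} → Support ⟦ s ⟧ α → Occurs α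
    support⇒occurs {α} cα≉0 = decidable-stable (occurs? α) λ ¬occurs →
      cα≉0 (trans (coeff-⟦⟧ s α) (sumOver-zero s (term≈0 ¬occurs)))
      where
      term≈0 : ¬ Occurs α → ∀ {t} → t ∈ s → μ t * coeff (q t) α ≈ 0#
      term≈0 ¬occurs {t} t∈s with μ t ≟ 0# | coeff (q t) α ≟ 0#
      ... | yes μ≈0 | _       = trans (*-congʳ μ≈0) (zeroˡ _)
      ... | no _    | yes c≈0 = trans (*-congˡ c≈0) (zeroʳ _)
      ... | no μ≉0  | no c≉0  =
        contradiction (Any.map (λ { ≡.refl → μ≉0 , c≉0 }) t∈s) ¬occurs

    -- Strictly above every degree listed in the circuits or in `h`, so that graded weights separate
    -- all exponents involved.
    B : ℕ
    B = suc (max 0 (map ∣_∣ (circuitExponents ++ exponents h)))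

    open Kronecker B

    φ : Exponent n → ℕ
    φ = weight gradedWeights

    below-B : ∀ {α} → α ∈ circuitExponents ++ exponents h → ∣ α ∣ ℕ.< B
    below-B α∈ = s≤s (All.lookup (xs≤max 0 _) (∈-map⁺ ∣_∣ α∈))

    occurs<B : ∀ {α} → Occurs α → ∣ α ∣ ℕ.< B
    occurs<B = below-B ∘ ∈-++⁺ˡ ∘ occurs⇒∈

    support<B : ∀ {α} → Support h α → ∣ α ∣ ℕ.< B
    support<B = below-B ∘ ∈-++⁺ʳ circuitExponents ∘ support⇒∈ h

    -- The sum `α* +ᵉ β*` arises from one pair of exponents only, so its coefficient is the product
    -- of the two leading coefficients. The one of `⟦ s ⟧` is nonzero because every weighted circuit
    -- has a nonnegative coefficient at `α*` and one of these is nonzero. Hence `deg` applies to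
    -- this exponent.
    leading-degree : ∀ {α* β*} → Occurs α* → (∀ {α} → Occurs α → φ α ℕ.≤ φ α*) →
                     Support h β* → (∀ {β} → Support h β → φ β ℕ.≤ φ β*) → ∣ α* +ᵉ β* ∣ ℕ.≤ d
    leading-degree {α*} {β*} α*-occurs α*-max β*∈h β*-max =
      deg (α* +ᵉ β*) (λ ≈0 → *-≉0 leading≉0 β*∈h (trans (sym product) ≈0))
      where
      α*-unique : ∀ {α} → Occurs α → φ α ≡ φ α* → α ≡ α*
      α*-unique {α} occ = gradedWeight-injective α α* (occurs<B occ) (occurs<B α*-occurs)
      unique : ∀ {α β} → Support ⟦ s ⟧ α → Support h β → α +ᵉ β ≡ α* +ᵉ β* → α ≡ α* × β ≡ β*
      unique {α} {β} α∈s β∈h eq = α*-unique occ α-eq ,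
        gradedWeight-injective β β* (support<B β∈h) (support<B β*∈h)
          (ℕ.+-cancelˡ-≡ (φ α) _ _ (≡.trans φ-eq (≡.cong (ℕ._+ φ β*) (≡.sym α-eq))))
        where
        occ : Occurs α
        occ = support⇒occurs α∈s
        φ-eq : φ α ℕ.+ φ β ≡ φ α* ℕ.+ φ β*
        φ-eq = ≡.trans (≡.sym (weight-zipWith-+ gradedWeights α β))
                 (≡.trans (≡.cong φ eq) (weight-zipWith-+ gradedWeights α* β*))
        -- Weights are additive and neither part exceeds its maximum, so equal sums force equality
        -- in both parts.
        α-eq : φ α ≡ φ α*
        α-eq = ℕ.≤-antisym (α*-max occ) (ℕ.+-cancelʳ-≤ (φ β) _ _
                 (ℕ.≤-trans (ℕ.+-monoʳ-≤ (φ α*) (β*-max β∈h)) (ℕ.≤-reflexive (≡.sym φ-eq))))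
      product : coeff (⟦ s ⟧ ⊗ h) (α* +ᵉ β*) ≈ coeff ⟦ s ⟧ α* * coeff h β*
      product = coeff-⊗-unique ⟦ s ⟧ h unique
      leading : ∀ {t} → t ∈ s → μ t ≉ 0# → Leading gradedWeights (q t) α*
      leading t∈s μ≉0 β β∈q = compare (ℕ.m≤n⇒m<n∨m≡n (α*-max occ))
        where
        occ : Occurs β
        occ = Any.map (λ { ≡.refl → μ≉0 , β∈q }) t∈s
        compare : φ β ℕ.< φ α* ⊎ φ β ≡ φ α* → β ≡ α* ⊎ φ β ℕ.< φ α*
        compare (inj₁ β<α*) = inj₂ β<α*
        compare (inj₂ β≡α*) = inj₁ (α*-unique occ β≡α*)
      term≥0 : ∀ {t} → t ∈ s → 0# ≤ μ t * coeff (q t) α*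
      term≥0 {t} t∈s with μ t ≟ 0#
      ... | yes μ≈0 = ≤-reflexive (sym (trans (*-congʳ μ≈0) (zeroˡ _)))
      ... | no μ≉0  = *-nonNeg (μ≥0 t)
        (circuit-leadingCoeff-nonNeg gradedWeights (q t) (q-circuit t) α* (leading t∈s μ≉0))
      leading≉0 : coeff ⟦ s ⟧ α* ≉ 0#
      leading≉0 ≈0 = sumOver-≉0 s term≥0 (Any.map (λ (μ≉0 , c≉0) → *-≉0 μ≉0 c≉0) α*-occurs)
                       (trans (sym (coeff-⟦⟧ s α*)) ≈0)

    -- In a graded order the exponents of largest weight also have the largest degree, so the bound
    -- at the leading pair covers every pair, even one whose terms cancel in the product.
    degree-bound : ∀ {α β} → Occurs α → Support h β → ∣ α +ᵉ β ∣ ℕ.≤ d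
    degree-bound {α} {β} α-occurs β∈h =
      let α* , α*-occurs , α*-max = maximal φ occurs? circuitExponents occurs⇒∈ α-occurs
          β* , β*∈h , β*-max = maximal φ (support? h) (exponents h) (support⇒∈ h) β∈h
      in begin
      ∣ α +ᵉ β ∣         ≡⟨ sum-zipWith-+ α β ⟩
      ∣ α ∣ ℕ.+ ∣ β ∣    ≤⟨ ℕ.+-mono-≤ (gradedWeight-mono⁻ α α* (occurs<B α*-occurs) (α*-max α-occurs))
                                       (gradedWeight-mono⁻ β β* (support<B β*∈h) (β*-max β∈h)) ⟩
      ∣ α* ∣ ℕ.+ ∣ β* ∣  ≡⟨ sum-zipWith-+ α* β* ⟨
      ∣ α* +ᵉ β* ∣       ≤⟨ leading-degree α*-occurs α*-max β*∈h β*-max ⟩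
      d                  ∎
      where open ℕ.≤-Reasoning

    degree-circuit : ∀ {t} → t ∈ s → μ t ≉ 0# → DegreeAtMost d (q t ⊗ h)
    degree-circuit {t} t∈s μ≉0 = degree-⊗ (q t) h λ α∈q →
      degree-bound (Any.map (λ { ≡.refl → μ≉0 , α∈q }) t∈s)

  -- Reducing the number of circuits in a certificate

  module Reduction {n m} (𝓗 : ConstrainedHypercube n m) (d : ℕ) (f : Poly n) where

    open ConstrainedHypercube 𝓗 using (Factor; productOf)

    module _ {N : ℕ} where

      value : SONCPoly n × Vec Factor N → Poly n
      value (s , H) = ⟦ s ⟧ ⊗ productOf H

      -- A generator of the cone. The degree bound is stored with it, so that it holds for any
      -- subfamily and any new weights.
      record Item : Set where
        constructor item
        field
          circuit : WeightedCircuit n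
          factors : Vec Factor N
        vector : Poly n
        vector = q circuit ⊗ productOf factors
        field
          degree : DegreeAtMost d vector

      open Item

      coeff-above-degree : ∀ α → ¬ ∣ α ∣ ℕ.≤ d → ∀ c (i : Item) → c * coeff (vector i) α ≈ 0#
      coeff-above-degree α α≰d c i =
        trans (*-congˡ (decidable-stable (coeff (vector i) α ≟ 0#) (α≰d ∘ degree i α))) (zeroʳ c)

      total-coeff : Exponent n → List Item → ℝ
      total-coeff α = sumOver (λ i → μ (circuit i) * coeff (vector i) α)

      itemsOf : ∀ (H : Vec Factor N) s → (∀ {t} → t ∈ s → μ t ≉ 0# → DegreeAtMost d (q t ⊗ productOf H)) →
        Σ[ is ∈ List Item ] (∀ α → sumOver (λ t → μ t * coeff (q t ⊗ productOf H) α) s ≈ total-coeff α is)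
      itemsOf H []      deg = [] , λ _ → refl
      itemsOf H (t ∷ s) deg with μ t ≟ 0# | itemsOf H s (deg ∘ there)
      -- A circuit of weight zero is discarded, since its vector may exceed degree `d`.
      ... | yes μ≈0 | is , eq = is , λ α →
            trans (+-cong (trans (*-congʳ μ≈0) (zeroˡ _)) (eq α)) (+-identityˡ _)
      ... | no μ≉0  | is , eq = item t H (deg (here ≡.refl) μ≉0) ∷ is , λ α → +-congˡ (eq α)

      flatten : ∀ summands → All (DegreeAtMost d ∘ value) summands →
        Σ[ is ∈ List Item ] (∀ α → coeff (sumPoly (map value summands)) α ≈ total-coeff α is)
      flatten []                  []            = [] , λ _ → refl
      flatten ((s , H) ∷ summands) (deg ∷ degs)
        = let is , eq  = itemsOf H s (NoCancellation.degree-circuit s (productOf H) deg)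
              js , eq′ = flatten summands degs
          in is ++ js , λ α → trans (coeff-++ (value (s , H)) _ α)
               (trans (+-cong (trans (coeff-⟦⟧⊗ s (productOf H) α) (eq α)) (eq′ α))
                      (sym (sumOver-++ is js)))

      -- Each new summand holds exactly one circuit, so that counting circuits amounts to counting
      -- summands.
      rescale : ∀ (i : Item) μ′ → 0# ≤ μ′ → SONCPoly n × Vec Factor N
      rescale i μ′ μ′≥0 = record { μ = μ′ ; μ≥0 = μ′≥0 ; q = q (circuit i)
                                 ; q-circuit = q-circuit (circuit i) } ∷ [] , factors i

      coeff-rescale : ∀ i μ′ (μ′≥0 : 0# ≤ μ′) α →
                      coeff (value (rescale i μ′ μ′≥0)) α ≈ μ′ * coeff (vector i) α
      coeff-rescale i μ′ μ′≥0 α =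
        trans (coeff-⟦⟧⊗ (proj₁ (rescale i μ′ μ′≥0)) (productOf (factors i)) α) (+-identityʳ _)

      degree-rescale : ∀ i μ′ (μ′≥0 : 0# ≤ μ′) → DegreeAtMost d (value (rescale i μ′ μ′≥0))
      degree-rescale i μ′ μ′≥0 α c≉0 = degree i α λ v≈0 →
        c≉0 (trans (coeff-rescale i μ′ μ′≥0 α) (trans (*-congˡ v≈0) (zeroʳ μ′)))

      coeff-sumPoly-tabulate : ∀ {l} (g : Fin l → SONCPoly n × Vec Factor N) α →
        coeff (sumPoly (map value (tabulate g))) α ≈ sum (λ i → coeff (value (g i)) α)
      coeff-sumPoly-tabulate {zero}  g α = refl
      coeff-sumPoly-tabulate {suc l} g α =
        trans (coeff-++ (value (g zero)) _ α) (+-congˡ (coeff-sumPoly-tabulate (g ∘ suc) α))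

      count-tabulate : ∀ {l} (g : Fin l → SONCPoly n × Vec Factor N) → (∀ i → length (proj₁ (g i)) ≡ 1) →
        ℕ.sum (map (λ (s , _) → length s) (tabulate g)) ≡ l
      count-tabulate {zero}  g single = ≡.refl
      count-tabulate {suc l} g single = ≡.cong₂ ℕ._+_ (single zero) (count-tabulate (g ∘ suc) (single ∘ suc))

    reduce : Certificate 𝓗 d f →
             Σ[ cert ∈ Certificate 𝓗 d f ] (Certificate.circuitCount cert ℕ.≤ length (exponentsUpTo n d))
    reduce cert = record
      { q             = Certificate.q cert
      ; q≥1           = Certificate.q≥1 cert
      ; summands      = tabulate g
      ; decomposition = decomposition
      ; degree        = tabulate⁺ {f = g} λ i → degree-rescale (items (σ i)) (μ′ i) (μ′≥0 i)
      } , ℕ.≤-trans (ℕ.≤-reflexive (count-tabulate g (λ _ → ≡.refl))) l≤L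
      where
      open Item
      flattened = flatten (Certificate.summands cert) (Certificate.degree cert)
      items = lookup (proj₁ flattened)
      reduced = conicCarathéodory (exponentsUpTo n d) (λ i → coeff (vector (items i)))
                                  (λ i → μ (circuit (items i))) (λ i → μ≥0 (circuit (items i)))
      l = proj₁ reduced
      σ = proj₁ (proj₂ reduced)
      μ′ = proj₁ (proj₂ (proj₂ reduced))
      l≤L = proj₁ (proj₂ (proj₂ (proj₂ reduced)))
      μ′≥0 = proj₁ (proj₂ (proj₂ (proj₂ (proj₂ reduced))))
      preserved = proj₂ (proj₂ (proj₂ (proj₂ (proj₂ reduced))))
      g : Fin l → SONCPoly n × Vec Factor (Certificate.q cert)
      g i = rescale (items (σ i)) (μ′ i) (μ′≥0 i)
      -- The reduction preserves only the coordinates in `exponentsUpTo n d`; at all others both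
      -- sides vanish by the degree bounds of the items.
      same-combination : ∀ α → sum (λ i → μ (circuit (items i)) * coeff (vector (items i)) α)
                             ≈ sum (λ i → μ′ i * coeff (vector (items (σ i))) α)
      same-combination α = go (∣ α ∣ ℕ.≤? d)
        where
        go : Dec (∣ α ∣ ℕ.≤ d) → sum (λ i → μ (circuit (items i)) * coeff (vector (items i)) α)
                               ≈ sum (λ i → μ′ i * coeff (vector (items (σ i))) α)
        go (yes α≤d) = sym (preserved (∈-exponentsUpTo α α≤d))
        go (no α≰d)  = trans (sum-zero λ i → coeff-above-degree α α≰d _ (items i))
                             (sym (sum-zero λ i → coeff-above-degree α α≰d _ (items (σ i))))
      decomposition : f ≋ sumPoly (map value (tabulate g))
      decomposition α = begin
        coeff f α
          ≈⟨ Certificate.decomposition cert α ⟩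
        coeff (sumPoly (map value (Certificate.summands cert))) α
          ≈⟨ proj₂ flattened α ⟩
        total-coeff α (proj₁ flattened)
          ≈⟨ sumOver≈sum-lookup (proj₁ flattened) ⟩
        sum (λ i → μ (circuit (items i)) * coeff (vector (items i)) α)
          ≈⟨ same-combination α ⟩
        sum (λ i → μ′ i * coeff (vector (items (σ i))) α)
          ≈⟨ sum-cong-≋ (λ i → coeff-rescale (items (σ i)) (μ′ i) (μ′≥0 i) α) ⟨
        sum (λ i → coeff (value (g i)) α)
          ≈⟨ coeff-sumPoly-tabulate g α ⟨
        coeff (sumPoly (map value (tabulate g))) α ∎
        where open ≈-Reasoning

open import Data.Nat.Base using (_≤_; _*_)

theorem4p9 : (𝓡 : CompleteOrderedField) → let open SONC 𝓡 in
    (π : ℕ → ℕ) → PolynomiallyBounded π → (d : ℕ) →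
    ∃[ K ] (∀ {n m} (𝓗 : ConstrainedHypercube n m) → m ≤ π n →
    (f : Poly n) → NonNegativeOn 𝓗 f → Certificate 𝓗 d f →
    Σ[ cert ∈ Certificate 𝓗 d f ]
    (Certificate.circuitCount cert ≤ K * binom≤ n d))
-- `binom≤ n d` counts the square-free monomials of degree at most `d`; the factor `2 ^ d` pays for
-- admitting all monomials and does not depend on `n`.
theorem4p9 𝓡 π _ d = 2 ℕ.^ d , λ {n} 𝓗 _ f _ cert →
  let cert′ , count≤ = Certificates.Reduction.reduce 𝓡 𝓗 d f cert
  in cert′ , ℕ.≤-trans count≤ (length-exponentsUpTo n d)
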